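{- Let $n = p_1p_2p_3$ where $p_1<p_2<p_3$ are odd primes satisfying the condition $$p_2 \ge 4(p_1-1)\quad\text{or}\quad p_3\ge p_1^2.$$ Then $$g(\Psi_n) = 2n\,\frac{1}{p_1} - \deg(\Psi_n).$$
   Context: $\Psi_n$ denotes the $n$-th inverse cyclotomic polynomial, $\Psi_n(x) = \prod_{1\le j\le n,\ \gcd(j,n)>1}(x-\zeta_n^j)$, where $\zeta_n$ is a primitive $n$-th root of unity. Maximum gap: for a nonzero univariate polynomial $f = c_1x^{e_1}+\cdots+c_tx^{e_t}$ with $c_1,\ldots,c_t\neq 0$ and $e_1<\cdots<e_t$, the maximum gap of $f$ is $g(f) = \max_{1\le i<t}(e_{i+1}-e_i)$, with $g(f)=0$ when $t=1$. -}

module Defs where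

open import Algebra.Apartness.Bundles using (HeytingField; HeytingCommutativeRing)
open import Algebra.Bundles using (CommutativeRing)
import Algebra.Properties.Semiring.Exp as Exp
import Algebra.Properties.Semiring.Mult as Mult
open import Data.List.Base using (List; []; _∷_; map; filter; foldr; replicate; upTo; _++_)
open import Data.List.Extrema.Nat using (max)
open import Data.List.NonEmpty as List⁺ using (List⁺; toList)
open import Data.List.Relation.Unary.All using (All)
open import Data.List.Relation.Unary.Linked using (Linked)
open import Data.Nat.Base using (ℕ; zero; suc; _<_; _∸_)
open import Data.Nat.Divisibility using (_∤_)
open import Data.Nat.GCD using (gcd)
open import Data.Nat.Primality using (Prime)
open import Data.Nat.Properties using (_<?_)
open import Data.Product.Base using (_×_; _,_; proj₁; proj₂)
open import Level using (_⊔_)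

OddPrime : ℕ → Set
OddPrime p = Prime p × 2 ∤ p

gaps : List ℕ → List ℕ
gaps []           = []
gaps (_ ∷ [])     = []
gaps (d ∷ e ∷ es) = (e ∸ d) ∷ gaps (e ∷ es)

-- The apartness _#_ of a Heyting field plays the role of ≠.  Lacking ℂ, we take
-- ζ in an arbitrary field K; the hypotheses on K and ζ are stated separately.
module _ {c ℓ₁ ℓ₂} (K : HeytingField c ℓ₁ ℓ₂) where

  open HeytingField K using (Carrier; _≈_; _#_; _+_; _*_; -_; 0#; 1#; heytingCommutativeRing)
  open HeytingCommutativeRing heytingCommutativeRing using (commutativeRing)
  open CommutativeRing commutativeRing using (semiring)
  open Exp semiring using (_^_)
  open Mult semiring using () renaming (_×_ to _·_)

  CharacteristicZero : Set ℓ₂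
  CharacteristicZero = ∀ m → suc m · 1# # 0#

  record PrimitiveRoot (n : ℕ) (ζ : Carrier) : Set (ℓ₁ ⊔ ℓ₂) where
    field
      root  : ζ ^ n ≈ 1#
      order : ∀ {k} → 0 < k → k < n → ζ ^ k # 1#

  -- Coefficient lists, constant term first; trailing zeros are allowed, so
  -- polynomials are compared by _≋_.
  Poly : Set c
  Poly = List Carrier

  coeff : Poly → ℕ → Carrier
  coeff []      _       = 0#
  coeff (a ∷ f) zero    = a
  coeff (a ∷ f) (suc k) = coeff f k

  infix 4 _≋_
  _≋_ : Poly → Poly → Set ℓ₁
  f ≋ g = ∀ k → coeff f k ≈ coeff g k

  infixl 6 _⊞_
  _⊞_ : Poly → Poly → Poly
  []      ⊞ g       = g
  (a ∷ f) ⊞ []      = a ∷ f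
  (a ∷ f) ⊞ (b ∷ g) = (a + b) ∷ (f ⊞ g)

  infixl 7 _⊠_
  _⊠_ : Poly → Poly → Poly
  []      ⊠ g = []
  (a ∷ f) ⊠ g = map (a *_) g ⊞ (0# ∷ (f ⊠ g))

  X-_ : Carrier → Poly
  X- a = - a ∷ 1# ∷ []

  monomial : Carrier → ℕ → Poly
  monomial a e = replicate e 0# ++ a ∷ []

  Ψ : ℕ → Carrier → Poly
  Ψ n ζ = foldr _⊠_ (1# ∷ [])
    (map (λ j → X- (ζ ^ j)) (filter (λ j → 1 <? gcd j n) (map suc (upTo n))))

  -- f = c₁x^e₁ + ⋯ + cₜx^eₜ with t ≥ 1, all cᵢ nonzero and e₁ < ⋯ < eₜ.  The
  -- exponents are determined by f, hence so are its degree and maximum gap;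
  -- they are read off an expansion because whether a coefficient vanishes
  -- need not be decidable in K.
  record Expansion (f : Poly) : Set (c ⊔ ℓ₁ ⊔ ℓ₂) where
    field
      terms      : List⁺ (Carrier × ℕ)
      nonzero    : All (λ t → proj₁ t # 0#) (toList terms)
      increasing : Linked _<_ (map proj₂ (toList terms))
      expands    : f ≋ foldr _⊞_ [] (map (λ (a , e) → monomial a e) (toList terms))

    degree : ℕ
    degree = proj₂ (List⁺.last terms)

    -- The base value 0 only matters for a single term.
    maxGap : ℕ
    maxGap = max 0 (gaps (map proj₂ (toList terms)))

{-# OPTIONS --safe #-}
-- With x_m = x^m − 1, multiplicative inclusion–exclusion over the j ≤ n = pqr sharing
-- a factor with n gives Ψ_n = x_qr A, where A x_p x_q x_r = x_pq x_pr x_1.  Hence Ψ_n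
-- consists of −A and of A shifted by qr, separated by a gap of length qr − deg A.
-- Now A (1 + x + ⋯ + x^(r−1)) is the sum of all x^(pv+qu) with v < r and u < p, which
-- has a nonzero coefficient in every window of length p below its degree, so that the
-- gaps of A have length at most r + p − 1; the condition on p, q and r makes this at
-- most qr − deg A.
module Submission where

open import Defs
open import Algebra.Apartness.Bundles using (HeytingField; HeytingCommutativeRing)
import Algebra.Apartness.Properties.HeytingCommutativeRing as HeytingProperties
open import Algebra.Bundles using (CommutativeRing; CommutativeMonoid)
open import Algebra.Definitions using (Invertible)
import Algebra.Properties.CommutativeSemigroup as CommutativeSemigroupProperties
import Algebra.Properties.Ring as RingProperties
import Algebra.Properties.Semiring.Exp as Exp
import Algebra.Properties.Semiring.Mult as Mult
import Algebra.Solver.CommutativeMonoid as MonoidSolver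
open import Data.Bool.Base using (Bool; true; false; if_then_else_; _∧_; _∨_; not)
open import Data.Bool.Properties using (∧-assoc)
open import Data.Empty using (⊥)
import Data.Integer.Base as ℤ
import Data.Integer.Properties as ℤ
import Data.Integer.Tactic.RingSolver as ℤ
open import Data.List.Base using (List; []; _∷_; [_]; _∷ʳ_; map; filter; foldr; applyUpTo; upTo; initLast; _∷ʳ′_)
open import Data.List.Extrema.Nat using (max; max≤v⁺; v≤max⁺)
open import Data.List.Membership.Propositional using (_∈_)
open import Data.List.Membership.Propositional.Properties using (∈-filter⁺; ∈-filter⁻; ∈-upTo⁺; ∈-upTo⁻; ∈-++⁺ˡ; ∈-++⁺ʳ; ∈-++⁻)
open import Data.List.NonEmpty as List⁺ using (List⁺; toList)
open import Data.List.Properties using (map-++; map-∘; map-id; ∷ʳ-injectiveʳ)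
open import Data.List.Relation.Unary.All as All using (All; []; _∷_)
import Data.List.Relation.Unary.All.Properties as All
open import Data.List.Relation.Unary.AllPairs using (AllPairs; []; _∷_)
import Data.List.Relation.Unary.AllPairs.Properties as AllPairs
open import Data.List.Relation.Unary.Any as Any using (here; there)
open import Data.List.Relation.Unary.Linked using (Linked)
open import Data.List.Relation.Unary.Linked.Properties using (AllPairs⇒Linked)
open import Data.Nat.Base as ℕ using (ℕ; zero; suc; _<_; _≤_; z≤n; s≤s; s<s; z<s; s≤s⁻¹)
open import Data.Nat.Divisibility
open import Data.Nat.GCD using (gcd; gcd[m,n]∣m; gcd[m,n]∣n; gcd-greatest; gcd[m,n]≢0)
open import Data.Nat.Primality using (Prime; euclidsLemma; prime⇒irreducible; prime⇒nonZero; prime⇒nonTrivial; ¬prime[1])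
open import Data.Nat.Primality.Factorisation using (factorise)
import Data.Nat.Properties as ℕ
open import Data.Nat.Tactic.RingSolver using (solve-∀)
open import Data.Product.Base using (_×_; _,_; proj₁; proj₂; ∃-syntax)
import Data.Rational.Base as ℚ
import Data.Rational.Properties as ℚ
import Data.Rational.Unnormalised.Base as ℚᵘ
import Data.Rational.Unnormalised.Properties as ℚᵘ
open import Data.Sum.Base using (_⊎_; inj₁; inj₂; [_,_]′)
open import Function.Bundles using (_⇔_; mk⇔)
open import Relation.Binary.Definitions using (tri<; tri≈; tri>)
open import Relation.Binary.PropositionalEquality as ≡ using (_≡_; _≢_)
import Relation.Binary.Reasoning.Setoid as SetoidReasoning
open import Relation.Nullary.Decidable using (does; yes; no; dec-true; dec-false; does-⇔; _×-dec_; _⊎-dec_; _because_)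
open import Relation.Nullary.Negation using (contradiction; ¬_)
open import Relation.Unary as U using (Pred)

-- The exponents of Ψ_n can be listed only if every coefficient is known to vanish or to be apart
-- from 0, and this need not be decidable in K. The coefficients are integers, however, and in
-- characteristic 0 an integer can be tested. Integrality is invisible in a product over powers of
-- ζ; it comes from the equation for A. To divide by x^m - 1 there, the computations take place
-- among formal power series, where x^m - 1 is a unit whose inverse is minus a geometric series. The
-- bound on the gaps of A rests on the absence of cancellation: the sum of the x^(pv+qu) has natural
-- coefficients, so in characteristic 0 every exponent that occurs has a coefficient apart from 0. A
-- gap of length at least r + p in A would make p consecutive coefficients of A (1 + x + ⋯ +
-- x^(r-1)) vanish, as each of them adds up r consecutive coefficients of A. Comparing degrees in
-- the equation for A yields deg A + p + r - 1 = pr + (p - 1)q, so what the condition on p, q and r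
-- has to supply is pr + (p - 1)q ≤ qr.

-- Formal power series over a commutative ring.

module PowerSeries {c ℓ} (R : CommutativeRing c ℓ) where

  open CommutativeRing R
  open RingProperties ring
  open CommutativeSemigroupProperties +-commutativeSemigroup using (x∙yz≈y∙xz; interchange)
  open SetoidReasoning setoid

  Series : Set c
  Series = ℕ → Carrier

  infix  4 _≐_
  infixl 6 _⊕_
  infixl 7 _⊛_

  _≐_ : Series → Series → Set ℓ
  f ≐ g = ∀ k → f k ≈ g k

  _⊕_ : Series → Series → Series
  (f ⊕ g) k = f k + g k

  tail : Series → Series
  tail f k = f (suc k)

  -- The Cauchy product, by splitting off the constant term of the first factor: f g = f₀ g + x
  -- (tail f) g. This form replaces finite sums by induction on the index.
  _⊛_ : Series → Series → Series
  (f ⊛ g) zero    = f 0 * g 0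
  (f ⊛ g) (suc k) = f 0 * g (suc k) + (tail f ⊛ g) k

  constant : Carrier → Series
  constant a zero    = a
  constant a (suc _) = 0#

  ⊛-cong : ∀ {f f′ g g′} → f ≐ f′ → g ≐ g′ → f ⊛ g ≐ f′ ⊛ g′
  ⊛-cong f≐f′ g≐g′ zero    = *-cong (f≐f′ 0) (g≐g′ 0)
  ⊛-cong f≐f′ g≐g′ (suc k) =
    +-cong (*-cong (f≐f′ 0) (g≐g′ (suc k))) (⊛-cong (λ i → f≐f′ (suc i)) g≐g′ k)

  ⊛-vanishes : ∀ f g m → (∀ i j → i ℕ.+ j ≡ m → f i * g j ≈ 0#) → (f ⊛ g) m ≈ 0#
  ⊛-vanishes f g zero    fg≈0 = fg≈0 0 0 ≡.refl
  ⊛-vanishes f g (suc m) fg≈0 = begin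
    f 0 * g (suc m) + (tail f ⊛ g) m  ≈⟨ +-cong (fg≈0 0 (suc m) ≡.refl)
      (⊛-vanishes (tail f) g m (λ i j i+j≡m → fg≈0 (suc i) j (≡.cong suc i+j≡m))) ⟩
    0# + 0#                           ≈⟨ +-identityˡ 0# ⟩
    0#                                ∎

  ⊛-distribʳ : ∀ h f g → (f ⊕ g) ⊛ h ≐ f ⊛ h ⊕ g ⊛ h
  ⊛-distribʳ h f g zero    = distribʳ _ _ _
  ⊛-distribʳ h f g (suc k) = begin
    (f 0 + g 0) * h (suc k) + ((tail f ⊕ tail g) ⊛ h) k
      ≈⟨ +-cong (distribʳ _ _ _) (⊛-distribʳ h (tail f) (tail g) k) ⟩
    (f 0 * h (suc k) + g 0 * h (suc k)) + ((tail f ⊛ h) k + (tail g ⊛ h) k)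
      ≈⟨ interchange _ _ _ _ ⟩
    (f ⊛ h ⊕ g ⊛ h) (suc k) ∎

  -- The mirror image of the defining recursion, splitting off the constant term of the second
  -- factor; commutativity follows from it by induction.
  ⊛-unfoldʳ : ∀ f g k → (f ⊛ g) (suc k) ≈ f (suc k) * g 0 + (f ⊛ tail g) k
  ⊛-unfoldʳ f g zero    = +-comm _ _
  ⊛-unfoldʳ f g (suc k) = trans (+-congˡ (⊛-unfoldʳ (tail f) g k)) (x∙yz≈y∙xz _ _ _)

  ⊛-comm : ∀ f g → f ⊛ g ≐ g ⊛ f
  ⊛-comm f g zero    = *-comm _ _
  ⊛-comm f g (suc k) = trans (⊛-unfoldʳ f g k) (+-cong (*-comm _ _) (⊛-comm f (tail g) k))

  scale-⊛ : ∀ a f g k → ((λ i → a * f i) ⊛ g) k ≈ a * (f ⊛ g) k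
  scale-⊛ a f g zero    = *-assoc _ _ _
  scale-⊛ a f g (suc k) = begin
    a * f 0 * g (suc k) + ((λ i → a * tail f i) ⊛ g) k
      ≈⟨ +-cong (*-assoc _ _ _) (scale-⊛ a (tail f) g k) ⟩
    a * (f 0 * g (suc k)) + a * (tail f ⊛ g) k  ≈⟨ distribˡ _ _ _ ⟨
    a * (f ⊛ g) (suc k)                         ∎

  ⊛-assoc : ∀ f g h → (f ⊛ g) ⊛ h ≐ f ⊛ (g ⊛ h)
  ⊛-assoc f g h zero    = *-assoc _ _ _
  ⊛-assoc f g h (suc k) = begin
    f 0 * g 0 * h (suc k) + (((λ i → f 0 * tail g i) ⊕ tail f ⊛ g) ⊛ h) k
      ≈⟨ +-cong (*-assoc _ _ _) (⊛-distribʳ h _ _ k) ⟩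
    f 0 * (g 0 * h (suc k)) + (((λ i → f 0 * tail g i) ⊛ h) k + ((tail f ⊛ g) ⊛ h) k)
      ≈⟨ +-congˡ (+-cong (scale-⊛ (f 0) (tail g) h k) (⊛-assoc (tail f) g h k)) ⟩
    f 0 * (g 0 * h (suc k)) + (f 0 * (tail g ⊛ h) k + (tail f ⊛ (g ⊛ h)) k)
      ≈⟨ +-assoc _ _ _ ⟨
    f 0 * (g 0 * h (suc k)) + f 0 * (tail g ⊛ h) k + (tail f ⊛ (g ⊛ h)) k
      ≈⟨ +-congʳ (distribˡ _ _ _) ⟨
    (f ⊛ (g ⊛ h)) (suc k) ∎

  constant-⊛ : ∀ a f k → (constant a ⊛ f) k ≈ a * f k
  constant-⊛ a f zero    = refl
  constant-⊛ a f (suc k) =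
    trans (+-congˡ (⊛-vanishes (tail (constant a)) f k (λ _ _ _ → zeroˡ _))) (+-identityʳ _)

  ⊛-identityˡ : ∀ f → constant 1# ⊛ f ≐ f
  ⊛-identityˡ f k = trans (constant-⊛ 1# f k) (*-identityˡ _)

  ring⟦x⟧ : CommutativeRing c ℓ
  ring⟦x⟧ = record
    { Carrier = Series
    ; _≈_ = _≐_
    ; _+_ = _⊕_
    ; _*_ = _⊛_
    ; -_  = λ f k → - f k
    ; 0#  = λ _ → 0#
    ; 1#  = constant 1#
    ; isCommutativeRing = record
      { isRing = record
        { +-isAbelianGroup = record
          { isGroup = record
            { isMonoid = record
              { isSemigroup = record
                { isMagma = record
                  { isEquivalence = record
                    { refl  = λ _ → refl
                    ; sym   = λ f≐g k → sym (f≐g k)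
                    ; trans = λ f≐g g≐h k → trans (f≐g k) (g≐h k)
                    }
                  ; ∙-cong = λ f≐f′ g≐g′ k → +-cong (f≐f′ k) (g≐g′ k)
                  }
                ; assoc = λ f g h k → +-assoc (f k) (g k) (h k)
                }
              ; identity = (λ f k → +-identityˡ (f k)) , (λ f k → +-identityʳ (f k))
              }
            ; inverse = (λ f k → -‿inverseˡ (f k)) , (λ f k → -‿inverseʳ (f k))
            ; ⁻¹-cong = λ f≐g k → -‿cong (f≐g k)
            }
          ; comm = λ f g k → +-comm (f k) (g k)
          }
        ; *-cong = ⊛-cong
        ; *-assoc = ⊛-assoc
        ; *-identity = ⊛-identityˡ , (λ f k → trans (⊛-comm f _ k) (⊛-identityˡ f k))
        ; distrib =
            (λ f g h k → trans (⊛-comm f _ k) (trans (⊛-distribʳ f g h k)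
              (+-cong (⊛-comm g f k) (⊛-comm h f k))))
          , ⊛-distribʳ
        }
      ; *-comm = ⊛-comm
      }
    }

  open CommutativeRing ring⟦x⟧ public using () renaming (_-_ to _⊖_; 1# to 𝟏)
  open Exp (CommutativeRing.semiring ring⟦x⟧) public using () renaming (_^_ to _⊛^_)

  X : Series
  X zero    = 0#
  X (suc k) = constant 1# k

  X⊛-zero : ∀ f → (X ⊛ f) 0 ≈ 0#
  X⊛-zero f = zeroˡ _

  X⊛-suc : ∀ f k → (X ⊛ f) (suc k) ≈ f k
  X⊛-suc f k = trans (+-cong (zeroˡ _) (⊛-identityˡ f k)) (+-identityˡ _)

  X^⊛-+ : ∀ m f k → (X ⊛^ m ⊛ f) (m ℕ.+ k) ≈ f k
  X^⊛-+ zero    f k = ⊛-identityˡ f k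
  X^⊛-+ (suc m) f k = trans (⊛-assoc X _ f (suc m ℕ.+ k))
    (trans (X⊛-suc _ (m ℕ.+ k)) (X^⊛-+ m f k))

  X^⊛-< : ∀ {m k} f → k < m → (X ⊛^ m ⊛ f) k ≈ 0#
  X^⊛-< {suc m} {zero}  f _         = trans (⊛-assoc X (X ⊛^ m) f 0) (X⊛-zero (X ⊛^ m ⊛ f))
  X^⊛-< {suc m} {suc k} f (s<s k<m) =
    trans (⊛-assoc X _ f (suc k)) (trans (X⊛-suc _ k) (X^⊛-< f k<m))

  X^-coeff : ∀ m → (X ⊛^ m) m ≈ 1#
  X^-coeff zero    = refl
  X^-coeff (suc m) = trans (X⊛-suc _ m) (X^-coeff m)

  X^-coeff-≢ : ∀ {m k} → k ≢ m → (X ⊛^ m) k ≈ 0#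
  X^-coeff-≢ {zero}  {zero}  k≢m = contradiction ≡.refl k≢m
  X^-coeff-≢ {zero}  {suc k} k≢m = refl
  X^-coeff-≢ {suc m} {zero}  k≢m = X⊛-zero (X ⊛^ m)
  X^-coeff-≢ {suc m} {suc k} k≢m = trans (X⊛-suc _ k) (X^-coeff-≢ (λ k≡m → k≢m (≡.cong suc k≡m)))

  -- A series carries no degree, so this marks the monic polynomials among the series. For these,
  -- degrees add under multiplication over any ring.
  Monic : ℕ → Series → Set ℓ
  Monic d f = f d ≈ 1# × (∀ {k} → d < k → f k ≈ 0#)

  monic-⊛ : ∀ {a b f g} → Monic a f → Monic b g → Monic (a ℕ.+ b) (f ⊛ g)
  monic-⊛ {zero} {b} {f} {g} (f₀≈1 , f>0≈0) (gb≈1 , g>b≈0) =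
    trans (f⊛g≐g b) gb≈1 , λ b<k → trans (f⊛g≐g _) (g>b≈0 b<k)
    where
    f≐1 : f ≐ constant 1#
    f≐1 zero    = f₀≈1
    f≐1 (suc k) = f>0≈0 z<s
    f⊛g≐g : f ⊛ g ≐ g
    f⊛g≐g k = trans (⊛-cong f≐1 (λ _ → refl) k) (⊛-identityˡ g k)
  monic-⊛ {suc a} {b} {f} {g} (fa≈1 , f>a≈0) (gb≈1 , g>b≈0) =
    trans (drop (a ℕ.+ b) (s<s (ℕ.m≤n+m b a))) (proj₁ tail-monic) , above
    where
    tail-monic : Monic (a ℕ.+ b) (tail f ⊛ g)
    tail-monic = monic-⊛ (fa≈1 , λ a<k → f>a≈0 (s<s a<k)) (gb≈1 , g>b≈0)
    drop : ∀ k → b < suc k → (f ⊛ g) (suc k) ≈ (tail f ⊛ g) k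
    drop k b<k = trans (+-congʳ (trans (*-congˡ (g>b≈0 b<k)) (zeroʳ _))) (+-identityˡ _)
    above : ∀ {k} → suc a ℕ.+ b < k → (f ⊛ g) k ≈ 0#
    above {suc k} (s<s a+b<k) =
      trans (drop k (ℕ.m<n⇒m<1+n (ℕ.≤-<-trans (ℕ.m≤n+m b a) a+b<k))) (proj₂ tail-monic a+b<k)

  monic-unique : ¬ 1# ≈ 0# → ∀ {a b f} → Monic a f → Monic b f → a ≡ b
  monic-unique 1≉0 {a} {b} (fa≈1 , f>a≈0) (fb≈1 , f>b≈0) with ℕ.<-cmp a b
  ... | tri< a<b _ _ = contradiction (trans (sym fb≈1) (f>a≈0 a<b)) 1≉0
  ... | tri≈ _ a≡b _ = a≡b
  ... | tri> _ _ b<a = contradiction (trans (sym fa≈1) (f>b≈0 b<a)) 1≉0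

  X^-1-monic : ∀ {m} → 0 < m → Monic m (X ⊛^ m ⊖ 𝟏)
  X^-1-monic {suc m} _ =
      trans (+-cong (X^-coeff (suc m)) -0#≈0#) (+-identityʳ _)
    , λ { {suc k} m<k → trans (+-cong (X^-coeff-≢ (ℕ.>⇒≢ m<k)) -0#≈0#) (+-identityʳ _) }

  geometric : ℕ → Series
  geometric m k = if does (m ∣? k) then 1# else 0#

  -- This is (1 - x^m)(1 + x^m + x^(2m) + ⋯) = 1 with the opposite sign. That x^m - 1 is a unit is
  -- the source of both cancellation and integrality below.
  geometric-inverse : ∀ {m} → 0 < m → (X ⊛^ m ⊖ 𝟏) ⊛ geometric m ≐ (λ k → - 𝟏 k)
  geometric-inverse {m} 0<m k = begin
    ((X ⊛^ m ⊖ 𝟏) ⊛ geometric m) k   ≈⟨ ⊛-distribʳ (geometric m) (X ⊛^ m) _ k ⟩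
    (X ⊛^ m ⊛ geometric m) k + ((λ i → - 𝟏 i) ⊛ geometric m) k
      ≈⟨ +-congˡ (trans (⊛-cong {g = geometric m} (λ i → sym (-1*x≈-x (𝟏 i))) (λ _ → refl) k)
        (trans (scale-⊛ (- 1#) 𝟏 (geometric m) k) (trans (-1*x≈-x _) (-‿cong (⊛-identityˡ (geometric m) k))))) ⟩
    (X ⊛^ m ⊛ geometric m) k - geometric m k ≈⟨ difference ⟩
    - 𝟏 k                                      ∎
    where
    difference : (X ⊛^ m ⊛ geometric m) k - geometric m k ≈ - 𝟏 k
    difference with k ℕ.<? m
    ... | yes k<m = trans (+-cong (X^⊛-< (geometric m) k<m) (-‿cong (below k k<m))) (+-identityˡ _)
      where
      below : ∀ k → k < m → geometric m k ≈ 𝟏 k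
      below zero    _   with m ∣? 0
      ... | yes _   = refl
      ... | no m∤0  = contradiction (m ∣0) m∤0
      below (suc k) k<m with m ∣? suc k
      ... | yes m∣k = contradiction m∣k (>⇒∤ k<m)
      ... | no _    = refl
    ... | no k≮m with ℕ.m≤n⇒∃[o]m+o≡n (ℕ.≮⇒≥ k≮m)
    ...   | j , ≡.refl = begin
      (X ⊛^ m ⊛ geometric m) (m ℕ.+ j) - geometric m (m ℕ.+ j)
        ≈⟨ +-cong (X^⊛-+ m (geometric m) j) (-‿cong (period j)) ⟩
      geometric m j - geometric m j  ≈⟨ -‿inverseʳ _ ⟩
      0#                             ≈⟨ -0#≈0# ⟨
      - 0#                           ≈⟨ -‿cong (positive m 0<m) ⟨
      - 𝟏 (m ℕ.+ j)                  ∎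
      where
      period : ∀ j → geometric m (m ℕ.+ j) ≈ geometric m j
      period j with m ∣? m ℕ.+ j | m ∣? j
      ... | yes _     | yes _   = refl
      ... | yes m∣m+j | no m∤j  = contradiction (∣m+n∣m⇒∣n m∣m+j ∣-refl) m∤j
      ... | no m∤m+j  | yes m∣j = contradiction (∣m∣n⇒∣m+n ∣-refl m∣j) m∤m+j
      ... | no _      | no _    = refl
      positive : ∀ m → 0 < m → 𝟏 (m ℕ.+ j) ≈ 0#
      positive (suc _) _ = refl

  ⊛-closed : ∀ {p} (P : Pred Carrier p) →
    (∀ {a b} → P a → P b → P (a + b)) → (∀ {a b} → P a → P b → P (a * b)) →
    ∀ {f g} → (∀ k → P (f k)) → (∀ k → P (g k)) → ∀ k → P ((f ⊛ g) k)
  ⊛-closed P P+ P* Pf Pg zero    = P* (Pf 0) (Pg 0)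
  ⊛-closed P P+ P* Pf Pg (suc k) =
    P+ (P* (Pf 0) (Pg (suc k))) (⊛-closed P P+ P* (λ i → Pf (suc i)) Pg k)

-- Products over ranges, with factors switched on and off.

module RangeProduct {c ℓ} (M : CommutativeMonoid c ℓ) where

  open CommutativeMonoid M
  open CommutativeSemigroupProperties commutativeSemigroup using (interchange)

  ∏ : (ℕ → Carrier) → ℕ → Carrier
  ∏ f zero    = ε
  ∏ f (suc n) = f 0 ∙ ∏ (λ i → f (suc i)) n

  ∏-cong : ∀ {f g} → (∀ i → f i ≈ g i) → ∀ n → ∏ f n ≈ ∏ g n
  ∏-cong f≈g zero    = refl
  ∏-cong f≈g (suc n) = ∙-cong (f≈g 0) (∏-cong (λ i → f≈g (suc i)) n)

  ∏-∙ : ∀ f g n → ∏ f n ∙ ∏ g n ≈ ∏ (λ i → f i ∙ g i) n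
  ∏-∙ f g zero    = identityˡ ε
  ∏-∙ f g (suc n) = trans (interchange _ _ _ _) (∙-congˡ (∏-∙ _ _ n))

  ∏-ε : ∀ {f} n → (∀ {i} → i < n → f i ≈ ε) → ∏ f n ≈ ε
  ∏-ε zero    f≈ε = refl
  ∏-ε (suc n) f≈ε = trans (∙-cong (f≈ε z<s) (∏-ε n (λ i<n → f≈ε (s<s i<n)))) (identityˡ ε)

  ∏-+ : ∀ f m n → ∏ f (m ℕ.+ n) ≈ ∏ f m ∙ ∏ (λ i → f (m ℕ.+ i)) n
  ∏-+ f zero    n = sym (identityˡ _)
  ∏-+ f (suc m) n = trans (∙-congˡ (∏-+ _ m n)) (sym (assoc _ _ _))

  ∏-∷ʳ : ∀ f n → ∏ f (suc n) ≈ ∏ f n ∙ f n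
  ∏-∷ʳ f zero    = comm _ _
  ∏-∷ʳ f (suc n) = trans (∙-congˡ (∏-∷ʳ _ n)) (sym (assoc _ _ _))

  infix 9 _when_
  -- Omitted factors become trivial ones, so all products run over the same range and identities
  -- between them can be checked factor by factor.
  _when_ : Carrier → Bool → Carrier
  x when true  = x
  x when false = ε

  -- The indices start at 1, so each block of `d` of them contains exactly one multiple of `d`,
  -- namely its last.
  ∏-multiples : ∀ (u : ℕ → Carrier) {d} → 0 < d → ∀ m →
    ∏ (λ i → u (suc i) when does (d ∣? suc i)) (m ℕ.* d) ≈ ∏ (λ i → u (suc i ℕ.* d)) m
  ∏-multiples u {suc d} 0<d zero    = refl
  ∏-multiples u {suc d} 0<d (suc m) = begin
    ∏ v (suc d ℕ.+ m ℕ.* suc d)                 ≈⟨ reflexive (≡.cong (∏ v) (ℕ.+-comm (suc d) (m ℕ.* suc d))) ⟩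
    ∏ v (m ℕ.* suc d ℕ.+ suc d)                 ≈⟨ ∏-+ v (m ℕ.* suc d) (suc d) ⟩
    ∏ v (m ℕ.* suc d) ∙ ∏ w (suc d)             ≈⟨ ∙-cong (∏-multiples u 0<d m) (∏-∷ʳ w d) ⟩
    ∏ (λ i → u (suc i ℕ.* suc d)) m ∙ (∏ w d ∙ w d)
      ≈⟨ ∙-congˡ (trans (∙-cong (∏-ε d between) last) (identityˡ _)) ⟩
    ∏ (λ i → u (suc i ℕ.* suc d)) m ∙ u (suc m ℕ.* suc d) ≈⟨ ∏-∷ʳ _ m ⟨
    ∏ (λ i → u (suc i ℕ.* suc d)) (suc m)       ∎
    where
    open SetoidReasoning setoid
    v w : ℕ → Carrier
    v i = u (suc i) when does (suc d ∣? suc i)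
    w i = v (m ℕ.* suc d ℕ.+ i)
    between : ∀ {i} → i < d → w i ≈ ε
    between {i} i<d = reflexive (≡.cong (u (suc (m ℕ.* suc d ℕ.+ i)) when_) (dec-false (suc d ∣? _) λ d∣ →
      >⇒∤ (s<s i<d) (∣m+n∣m⇒∣n (≡.subst (suc d ∣_) (≡.sym (ℕ.+-suc (m ℕ.* suc d) i)) d∣) (n∣m*n m))))
    end≡ : suc (m ℕ.* suc d ℕ.+ d) ≡ suc m ℕ.* suc d
    end≡ = ≡.cong suc (ℕ.+-comm (m ℕ.* suc d) d)
    last : w d ≈ u (suc m ℕ.* suc d)
    last = reflexive (≡.trans
      (≡.cong (u (suc (m ℕ.* suc d ℕ.+ d)) when_) (dec-true (suc d ∣? _) (≡.subst (suc d ∣_) (≡.sym end≡) (n∣m*n (suc m)))))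
      (≡.cong u end≡))

  ∏-closed : ∀ {p} (P : Pred Carrier p) → P ε → (∀ {x y} → P x → P y → P (x ∙ y)) →
    ∀ {f} → (∀ i → P (f i)) → ∀ n → P (∏ f n)
  ∏-closed P Pε P∙ Pf zero    = Pε
  ∏-closed P Pε P∙ Pf (suc n) = P∙ (Pf 0) (∏-closed P Pε P∙ (λ i → Pf (suc i)) n)

  remove-multiples : ∀ x p q r →
    x when (p ∨ q ∨ r) ≈ x when p ∙ x when (not p ∧ (q ∨ r))
  remove-multiples x true  q r = sym (identityʳ x)
  remove-multiples x false q r = sym (identityˡ _)

  -- This counts occurrences of `x`. If `p` is false, it is [q ∨ r] + [q ∧ r] = [q] + [r]; if `p` is
  -- true, the first factor is trivial and the others match up to order. Negative terms are moved
  -- across the equation, as a monoid has no inverses.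
  inclusion-exclusion : ∀ x p q r →
    x when (not p ∧ (q ∨ r)) ∙ x when (q ∧ r) ∙ x when (p ∧ q) ∙ x when (p ∧ r)
      ≈ x when q ∙ x when r ∙ x when (p ∧ q ∧ r)
  inclusion-exclusion x true true true =
    ∙-congʳ (∙-congʳ (identityˡ x))
  inclusion-exclusion x true true false = ∙-congʳ (trans (∙-congʳ (identityˡ ε)) (comm ε x))
  inclusion-exclusion x true false true = trans (∙-congʳ (trans (∙-congʳ (identityˡ ε)) (identityˡ ε)))
    (sym (identityʳ _))
  inclusion-exclusion x true false false = ∙-congʳ (∙-congʳ (identityˡ ε))
  inclusion-exclusion x false true true = identityʳ _
  inclusion-exclusion x false true false = identityʳ _
  inclusion-exclusion x false false true = trans (identityʳ _) (∙-congʳ (comm x ε))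
  inclusion-exclusion x false false false = identityʳ _

-- Finite geometric sums.

module GeometricSum {c ℓ} (R : CommutativeRing c ℓ) where

  open CommutativeRing R
  open RingProperties ring
  open Exp semiring
  open SetoidReasoning setoid

  ∑^ : Carrier → ℕ → Carrier
  ∑^ y zero    = 0#
  ∑^ y (suc n) = ∑^ y n + y ^ n

  telescope : ∀ y n → (y - 1#) * ∑^ y n ≈ y ^ n - 1#
  telescope y zero    = trans (zeroʳ _) (sym (-‿inverseʳ 1#))
  telescope y (suc n) = begin
    (y - 1#) * (∑^ y n + y ^ n)              ≈⟨ distribˡ _ _ _ ⟩
    (y - 1#) * ∑^ y n + (y - 1#) * y ^ n     ≈⟨ +-cong (telescope y n) ([y-z]x≈yx-zx _ _ _) ⟩
    (y ^ n - 1#) + (y ^ suc n - 1# * y ^ n)  ≈⟨ +-congˡ (+-congˡ (-‿cong (*-identityˡ _))) ⟩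
    (y ^ n - 1#) + (y ^ suc n - y ^ n)       ≈⟨ +-comm _ _ ⟩
    (y ^ suc n - y ^ n) + (y ^ n - 1#)       ≈⟨ +-assoc _ _ _ ⟩
    y ^ suc n + (- y ^ n + (y ^ n - 1#))     ≈⟨ +-congˡ (sym (+-assoc _ _ _)) ⟩
    y ^ suc n + ((- y ^ n + y ^ n) - 1#)     ≈⟨ +-congˡ (+-congʳ (-‿inverseˡ _)) ⟩
    y ^ suc n + (0# - 1#)                    ≈⟨ +-congˡ (+-identityˡ _) ⟩
    y ^ suc n - 1#                           ∎

-- Linear factors and the factorisation of xⁿ - 1.

module LinearFactors {c ℓ} (R : CommutativeRing c ℓ) where

  open CommutativeRing R
  open RingProperties ring
  open Exp semiring
  open PowerSeries R
  open SetoidReasoning setoid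
  open RangeProduct (CommutativeRing.*-commutativeMonoid ring⟦x⟧)
  open RingProperties (CommutativeRing.ring ring⟦x⟧) using () renaming ([y-z]x≈yx-zx to ⊖-⊛)
  module K⟦x⟧ = CommutativeRing ring⟦x⟧

  X⊖_ : Carrier → Series
  X⊖ a = X ⊖ constant a

  X⊖-cong : ∀ {a b} → a ≈ b → X⊖ a ≐ X⊖ b
  X⊖-cong a≈b zero    = +-congˡ (-‿cong a≈b)
  X⊖-cong a≈b (suc k) = refl

  X⊖-⊛ : ∀ a f k → (X⊖ a ⊛ f) k ≈ (X ⊛ f) k - a * f k
  X⊖-⊛ a f k = trans (⊖-⊛ f X (constant a) k) (+-congˡ (-‿cong (constant-⊛ a f k)))

  X⊖-⊛-zero : ∀ a f → (X⊖ a ⊛ f) 0 ≈ - (a * f 0)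
  X⊖-⊛-zero a f = trans (X⊖-⊛ a f 0) (trans (+-congʳ (X⊛-zero f)) (+-identityˡ _))

  X⊖-⊛-suc : ∀ a f k → (X⊖ a ⊛ f) (suc k) ≈ f k - a * f (suc k)
  X⊖-⊛-suc a f k = trans (X⊖-⊛ a f (suc k)) (+-congʳ (X⊛-suc f k))

  X⊖-monic : ∀ a → Monic 1 (X⊖ a)
  X⊖-monic a = trans (+-congˡ -0#≈0#) (+-identityʳ _)
             , λ { {suc (suc k)} _ → trans (+-congˡ -0#≈0#) (+-identityʳ _) ; {suc zero} (s<s ()) }

  -- The substitution x ↦ ωx.
  dilate : Carrier → Series → Series
  dilate ω f k = ω ^ k * f k

  -- Substituting ωx for x in x - ωa gives ω(x - a).
  dilate-factor : ∀ ω a f → dilate ω (X⊖ (ω * a) ⊛ f) ≐ (λ k → ω * (X⊖ a ⊛ dilate ω f) k)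
  dilate-factor ω a f zero = begin
    1# * (X⊖ (ω * a) ⊛ f) 0       ≈⟨ *-identityˡ _ ⟩
    (X⊖ (ω * a) ⊛ f) 0            ≈⟨ X⊖-⊛-zero _ f ⟩
    - (ω * a * f 0)               ≈⟨ -‿cong (*-assoc _ _ _) ⟩
    - (ω * (a * f 0))             ≈⟨ -‿distribʳ-* _ _ ⟩
    ω * - (a * f 0)               ≈⟨ *-congˡ (-‿cong (*-congˡ (*-identityˡ (f 0)))) ⟨
    ω * - (a * dilate ω f 0)      ≈⟨ *-congˡ (X⊖-⊛-zero a (dilate ω f)) ⟨
    ω * (X⊖ a ⊛ dilate ω f) 0     ∎
  dilate-factor ω a f (suc k) = begin
    ω * ω ^ k * (X⊖ (ω * a) ⊛ f) (suc k)              ≈⟨ *-congˡ (X⊖-⊛-suc _ f k) ⟩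
    ω * ω ^ k * (f k - ω * a * f (suc k))             ≈⟨ *-assoc _ _ _ ⟩
    ω * (ω ^ k * (f k - ω * a * f (suc k)))           ≈⟨ *-congˡ (x[y-z]≈xy-xz _ _ _) ⟩
    ω * (ω ^ k * f k - ω ^ k * (ω * a * f (suc k)))   ≈⟨ *-congˡ (+-congˡ (-‿cong rearrange)) ⟩
    ω * (dilate ω f k - a * dilate ω f (suc k))       ≈⟨ *-congˡ (X⊖-⊛-suc a _ k) ⟨
    ω * (X⊖ a ⊛ dilate ω f) (suc k)                   ∎
    where
    rearrange : ω ^ k * (ω * a * f (suc k)) ≈ a * (ω * ω ^ k * f (suc k))
    rearrange = begin
      ω ^ k * (ω * a * f (suc k))    ≈⟨ *-assoc _ _ _ ⟨
      ω ^ k * (ω * a) * f (suc k)    ≈⟨ *-congʳ (trans (sym (*-assoc _ _ _)) (trans (*-comm _ _) (*-congˡ (*-comm _ _)))) ⟩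
      a * (ω * ω ^ k) * f (suc k)    ≈⟨ *-assoc _ _ _ ⟩
      a * (ω * ω ^ k * f (suc k))    ∎

  dilate-product : ∀ ω (a : ℕ → Carrier) n →
    dilate ω (∏ (λ i → X⊖ (ω * a i)) n) ≐ (λ k → ω ^ n * ∏ (λ i → X⊖ a i) n k)
  dilate-product ω a zero    zero    = refl
  dilate-product ω a zero    (suc k) = trans (zeroʳ _) (sym (zeroʳ _))
  dilate-product ω a (suc n) k = begin
    dilate ω (X⊖ (ω * a 0) ⊛ P) k                    ≈⟨ dilate-factor ω (a 0) P k ⟩
    ω * (X⊖ a 0 ⊛ dilate ω P) k                      ≈⟨ *-congˡ (⊛-comm _ (dilate ω P) k) ⟩
    ω * (dilate ω P ⊛ X⊖ a 0) k
      ≈⟨ *-congˡ (⊛-cong {f = dilate ω P} (dilate-product ω (λ i → a (suc i)) n) (λ _ → refl) k) ⟩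
    ω * ((λ i → ω ^ n * Q i) ⊛ X⊖ a 0) k             ≈⟨ *-congˡ (scale-⊛ (ω ^ n) Q _ k) ⟩
    ω * (ω ^ n * (Q ⊛ X⊖ a 0) k)                     ≈⟨ *-assoc _ _ _ ⟨
    ω ^ suc n * (Q ⊛ X⊖ a 0) k                       ≈⟨ *-congˡ (⊛-comm Q _ k) ⟩
    ω ^ suc n * (X⊖ a 0 ⊛ Q) k                       ∎
    where
    P Q : Series
    P = ∏ (λ i → X⊖ (ω * a (suc i))) n
    Q = ∏ (λ i → X⊖ a (suc i)) n

  product-monic : ∀ (a : ℕ → Carrier) n → Monic n (∏ (λ i → X⊖ a i) n)
  product-monic a zero    = refl , λ { {suc k} _ → refl }
  product-monic a (suc n) = monic-⊛ (X⊖-monic (a 0)) (product-monic (λ i → a (suc i)) n)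

  -- The product is invariant under x ↦ ωx up to the factor ωⁿ = 1, so its middle
  -- coefficients vanish; the factor x − 1 then determines the constant term.
  product-roots-of-unity : ∀ ω n → ω ^ suc n ≈ 1# →
    (∀ {k} → 0 < k → k < suc n → ∀ c → ω ^ k * c ≈ c → c ≈ 0#) →
    ∏ (λ i → X⊖ (ω ^ suc i)) (suc n) ≐ X ⊛^ suc n ⊖ 𝟏
  product-roots-of-unity ω n ωⁿ≈1 torsionfree = coefficients
    where
    N : ℕ
    N = suc n
    P Q : Series
    P = ∏ (λ i → X⊖ (ω ^ suc i)) N
    Q = ∏ (λ i → X⊖ (ω ^ suc i)) n

    P≐ : P ≐ X⊖ 1# ⊛ Q
    P≐ = K⟦x⟧.trans (∏-∷ʳ (λ i → X⊖ (ω ^ suc i)) n)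
      (K⟦x⟧.trans (K⟦x⟧.*-comm Q _) (K⟦x⟧.*-congʳ (X⊖-cong ωⁿ≈1)))

    -- Dilation turns the roots ω, ..., ω^N into 1, ..., ω^(N-1), which are the same roots up to
    -- order because ω^N = 1.
    invariant : ∀ k → ω ^ k * P k ≈ P k
    invariant k = begin
      ω ^ k * P k                               ≈⟨ dilate-product ω (λ i → ω ^ i) N k ⟩
      ω ^ N * ∏ (λ i → X⊖ (ω ^ i)) N k          ≈⟨ *-congʳ ωⁿ≈1 ⟩
      1# * (X⊖ 1# ⊛ Q) k                        ≈⟨ *-identityˡ _ ⟩
      (X⊖ 1# ⊛ Q) k                             ≈⟨ P≐ k ⟨
      P k                                       ∎

    P-monic : Monic N P
    P-monic = product-monic (λ i → ω ^ suc i) N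

    Q-monic : Monic n Q
    Q-monic = product-monic (λ i → ω ^ suc i) n

    -- In P = (x - 1) Q, the vanishing of a middle coefficient of P equates two neighbouring
    -- coefficients of Q. Descending from the leading coefficient makes all of them 1, so no product
    -- of roots has to be evaluated.
    Q-constant : ∀ i j → i ℕ.+ j ≡ n → Q j ≈ 1#
    Q-constant zero    j ≡.refl = proj₁ Q-monic
    Q-constant (suc i) j ≡.refl = trans (x∙y⁻¹≈ε⇒x≈y _ _ (begin
      Q j - Q (suc j)       ≈⟨ +-congˡ (-‿cong (*-identityˡ _)) ⟨
      Q j - 1# * Q (suc j)  ≈⟨ X⊖-⊛-suc 1# Q j ⟨
      (X⊖ 1# ⊛ Q) (suc j)   ≈⟨ P≐ (suc j) ⟨
      P (suc j)             ≈⟨ torsionfree z<s (s<s (s≤s (ℕ.m≤n+m j i))) _ (invariant (suc j)) ⟩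
      0#                    ∎)) (Q-constant i (suc j) (ℕ.+-suc i j))

    coefficients : P ≐ X ⊛^ N ⊖ 𝟏
    coefficients zero = begin
      P 0                      ≈⟨ P≐ 0 ⟩
      (X⊖ 1# ⊛ Q) 0            ≈⟨ X⊖-⊛-zero 1# Q ⟩
      - (1# * Q 0)             ≈⟨ -‿cong (trans (*-identityˡ _) (Q-constant n 0 (ℕ.+-identityʳ n))) ⟩
      - 1#                     ≈⟨ +-identityˡ _ ⟨
      0# - 1#                  ≈⟨ +-congʳ (X^-coeff-≢ {N} {0} (λ ())) ⟨
      (X ⊛^ N ⊖ 𝟏) 0           ∎
    coefficients (suc k) with ℕ.<-cmp (suc k) N
    ... | tri< k<N k≢N _ = trans (torsionfree z<s k<N _ (invariant (suc k)))
      (sym (trans (+-cong (X^-coeff-≢ k≢N) -0#≈0#) (+-identityʳ _)))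
    ... | tri≈ _ ≡.refl _ = trans (proj₁ P-monic) (sym (proj₁ (X^-1-monic {N} z<s)))
    ... | tri> _ _ N<k = trans (proj₂ P-monic N<k) (sym (proj₂ (X^-1-monic {N} z<s) N<k))

-- Series with natural or integer coefficients.

module IntegerElements {c ℓ} (R : CommutativeRing c ℓ) where

  open CommutativeRing R
  open RingProperties ring
  open Mult semiring using (×-homo-+; ×1-homo-*; ×-homo-1) renaming (_×_ to _·_)
  open SetoidReasoning setoid
  open CommutativeSemigroupProperties +-commutativeSemigroup using (interchange)
  open PowerSeries R
  private module K⟦x⟧ = CommutativeRing ring⟦x⟧
  open RingProperties K⟦x⟧.ring using () renaming (-‿distribʳ-* to -‿distribʳ-⊛; -‿involutive to ⊖-involutive)

  -- The images of ℕ, of the positive integers and of ℤ in `R`. Writing an integer as a difference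
  -- of naturals lets characteristic 0 decide later whether it vanishes, by comparing the two.
  IsNatural IsPositive IsInteger : Pred Carrier ℓ
  IsNatural a  = ∃[ n ] a ≈ n · 1#
  IsPositive a = ∃[ n ] a ≈ suc n · 1#
  IsInteger a  = ∃[ m ] ∃[ n ] a ≈ m · 1# - n · 1#

  natural-+ : ∀ {a b} → IsNatural a → IsNatural b → IsNatural (a + b)
  natural-+ (m , a≈m) (n , b≈n) = m ℕ.+ n , trans (+-cong a≈m b≈n) (sym (×-homo-+ 1# m n))

  natural-* : ∀ {a b} → IsNatural a → IsNatural b → IsNatural (a * b)
  natural-* (m , a≈m) (n , b≈n) = m ℕ.* n , trans (*-cong a≈m b≈n) (sym (×1-homo-* m n))

  natural⇒integer : ∀ {a} → IsNatural a → IsInteger a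
  natural⇒integer (m , a≈m) = m , 0 , trans a≈m (sym (trans (+-congˡ -0#≈0#) (+-identityʳ _)))

  positive⇒natural : ∀ {a} → IsPositive a → IsNatural a
  positive⇒natural (m , a≈m) = suc m , a≈m

  positive-+ : ∀ {a b} → IsPositive a → IsNatural b → IsPositive (a + b)
  positive-+ (m , a≈m) (n , b≈n) = m ℕ.+ n , trans (+-cong a≈m b≈n) (sym (×-homo-+ 1# (suc m) n))

  positive-* : ∀ {a b} → IsPositive a → IsPositive b → IsPositive (a * b)
  positive-* (m , a≈m) (n , b≈n) =
    n ℕ.+ m ℕ.* suc n , trans (*-cong a≈m b≈n) (sym (×1-homo-* (suc m) (suc n)))

  private
    minus-+ : ∀ a b a′ b′ → (a - b) + (a′ - b′) ≈ (a + a′) - (b + b′)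
    minus-+ a b a′ b′ = trans (interchange _ _ _ _) (+-congˡ (-‿+-comm b b′))

  integer-+ : ∀ {a b} → IsInteger a → IsInteger b → IsInteger (a + b)
  integer-+ {a} {b} (m , n , a≈) (m′ , n′ , b≈) = m ℕ.+ m′ , n ℕ.+ n′ , (begin
    a + b                                              ≈⟨ +-cong a≈ b≈ ⟩
    (m · 1# - n · 1#) + (m′ · 1# - n′ · 1#)            ≈⟨ minus-+ _ _ _ _ ⟩
    (m · 1# + m′ · 1#) - (n · 1# + n′ · 1#)
      ≈⟨ +-cong (×-homo-+ 1# m m′) (-‿cong (×-homo-+ 1# n n′)) ⟨
    (m ℕ.+ m′) · 1# - (n ℕ.+ n′) · 1#                  ∎)

  integer-neg : ∀ {a} → IsInteger a → IsInteger (- a)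
  integer-neg {a} (m , n , a≈) = n , m , (begin
    - a                      ≈⟨ -‿cong a≈ ⟩
    - (m · 1# - n · 1#)      ≈⟨ ⁻¹-anti-homo‿- _ _ ⟩
    n · 1# - m · 1#          ∎)

  integer-* : ∀ {a b} → IsInteger a → IsInteger b → IsInteger (a * b)
  integer-* {a} {b} (m , n , a≈) b-integer = cast (trans (*-congʳ a≈) ([y-z]x≈yx-zx b _ _))
    (integer-+ (times m) (integer-neg (times n)))
    where
    cast : ∀ {x y} → x ≈ y → IsInteger y → IsInteger x
    cast x≈y (m , n , y≈) = m , n , trans x≈y y≈
    times : ∀ m → IsInteger (m · 1# * b)
    times zero    = cast (zeroˡ b) (natural⇒integer (0 , refl))
    times (suc m) = cast (trans (distribʳ b 1# (m · 1#)) (+-congʳ (*-identityˡ b)))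
      (integer-+ b-integer (times m))

  0-natural : IsNatural 0#
  0-natural = 0 , refl

  1-positive : IsPositive 1#
  1-positive = 0 , sym (×-homo-1 1#)

  X^-natural : ∀ m k → IsNatural ((X ⊛^ m) k)
  X^-natural m k with k ℕ.≟ m
  ... | yes ≡.refl = proj₁ n , trans (X^-coeff m) (proj₂ n) where n = positive⇒natural 1-positive
  ... | no k≢m     = 0 , X^-coeff-≢ k≢m

  𝟏-natural : ∀ k → IsNatural (𝟏 k)
  𝟏-natural zero    = positive⇒natural 1-positive
  𝟏-natural (suc k) = 0-natural

  geometric-natural : ∀ m k → IsNatural (geometric m k)
  geometric-natural m k with m ∣? k
  ... | yes _ = positive⇒natural 1-positive
  ... | no _  = 0-natural

  X^-1-integer : ∀ m k → IsInteger ((X ⊛^ m ⊖ 𝟏) k)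
  X^-1-integer m k = integer-+ (natural⇒integer (X^-natural m k)) (integer-neg (natural⇒integer (𝟏-natural k)))

  integer-⊛ : ∀ {f g} → (∀ k → IsInteger (f k)) → (∀ k → IsInteger (g k)) →
    ∀ k → IsInteger ((f ⊛ g) k)
  integer-⊛ = ⊛-closed IsInteger integer-+ integer-*

  *-geometric-undoes : ∀ {m} f → 0 < m → K⟦x⟧.- ((f ⊛ (X ⊛^ m ⊖ 𝟏)) ⊛ geometric m) ≐ f
  *-geometric-undoes {m} f 0<m = K⟦x⟧.trans (K⟦x⟧.-‿cong (K⟦x⟧.trans (⊛-assoc f _ (geometric m))
    (K⟦x⟧.trans (K⟦x⟧.*-congˡ {f} (geometric-inverse 0<m)) (K⟦x⟧.sym (-‿distribʳ-⊛ f 𝟏)))))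
    (K⟦x⟧.trans (⊖-involutive _) (K⟦x⟧.*-identityʳ f))

  -- Dividing by x^m − 1 amounts to multiplying by a series with integer coefficients.
  integer-quotient : ∀ {m f} → 0 < m → (∀ k → IsInteger ((f ⊛ (X ⊛^ m ⊖ 𝟏)) k)) → ∀ k → IsInteger (f k)
  integer-quotient {m} {f} 0<m integral k =
    proj₁ i , proj₁ (proj₂ i) , trans (sym (*-geometric-undoes f 0<m k)) (proj₂ (proj₂ i))
    where
    i : IsInteger (- ((f ⊛ (X ⊛^ m ⊖ 𝟏)) ⊛ geometric m) k)
    i = integer-neg (integer-⊛ integral (λ k → natural⇒integer (geometric-natural m k)) k)

  -- Cancellation comes from multiplying by the geometric series, so it holds even if `R` has zero
  -- divisors.
  X^-1-cancelʳ : ∀ {m f g} → 0 < m → f ⊛ (X ⊛^ m ⊖ 𝟏) ≐ g ⊛ (X ⊛^ m ⊖ 𝟏) → f ≐ g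
  X^-1-cancelʳ {m} {f} {g} 0<m eq = K⟦x⟧.trans (K⟦x⟧.sym (*-geometric-undoes f 0<m))
    (K⟦x⟧.trans (K⟦x⟧.-‿cong (K⟦x⟧.*-congʳ eq)) (*-geometric-undoes g 0<m))

  -- Every contribution to the coefficient of index `i + j` is natural and one of them, `f i * g j`,
  -- is positive, so nothing can cancel.
  positive-⊛ : ∀ {f g} → (∀ k → IsNatural (f k)) → (∀ k → IsNatural (g k)) →
    ∀ i {j} → IsPositive (f i) → IsPositive (g j) → IsPositive ((f ⊛ g) (i ℕ.+ j))
  positive-⊛ f-nat g-nat zero {zero}  fi gj = positive-* fi gj
  positive-⊛ f-nat g-nat zero {suc j} fi gj =
    positive-+ (positive-* fi gj) (⊛-closed IsNatural natural-+ natural-* (λ k → f-nat (suc k)) g-nat j)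
  positive-⊛ {f} {g} f-nat g-nat (suc i) {j} fi gj = cast
    (positive-+ (positive-⊛ (λ k → f-nat (suc k)) g-nat i fi gj) (natural-* (f-nat 0) (g-nat (suc (i ℕ.+ j)))))
    where
    cast : IsPositive ((tail f ⊛ g) (i ℕ.+ j) + f 0 * g (suc (i ℕ.+ j))) → IsPositive ((f ⊛ g) (suc i ℕ.+ j))
    cast (n , eq) = n , trans (+-comm _ _) eq

  open GeometricSum ring⟦x⟧ public

  ∑X^ : ℕ → ℕ → Series
  ∑X^ m n = ∑^ (X ⊛^ m) n

  X^-assoc : ∀ m i → (X ⊛^ m) ⊛^ i ≐ X ⊛^ (m ℕ.* i)
  X^-assoc = Exp.^-assocʳ (CommutativeRing.semiring ring⟦x⟧) X

  X^^-natural : ∀ m i k → IsNatural (((X ⊛^ m) ⊛^ i) k)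
  X^^-natural m i k = proj₁ n , trans (X^-assoc m i k) (proj₂ n) where n = X^-natural (m ℕ.* i) k

  ∑X^-natural : ∀ m n k → IsNatural (∑X^ m n k)
  ∑X^-natural m zero    k = 0-natural
  ∑X^-natural m (suc n) k = natural-+ (∑X^-natural m n k) (X^^-natural m n k)

  ∑X^-positive : ∀ m {n i} → i < n → IsPositive (∑X^ m n (m ℕ.* i))
  ∑X^-positive m {suc n} {i} (s<s i≤n) with i ℕ.≟ n
  ... | no i≢n     = positive-+ (∑X^-positive m (ℕ.≤∧≢⇒< i≤n i≢n)) (X^^-natural m n (m ℕ.* i))
  ... | yes ≡.refl = proj₁ s , trans (+-comm _ _) (proj₂ s)
    where
    top : IsPositive (((X ⊛^ m) ⊛^ n) (m ℕ.* n))
    top = proj₁ 1-positive , trans (trans (X^-assoc m n _) (X^-coeff (m ℕ.* n))) (proj₂ 1-positive)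
    s = positive-+ top (∑X^-natural m n (m ℕ.* n))

  ∑X^-above : ∀ {n k} → n ≤ k → ∑X^ 1 n k ≈ 0#
  ∑X^-above {zero}  _   = refl
  ∑X^-above {suc n} n<k = trans (+-cong (∑X^-above (ℕ.<⇒≤ n<k))
    (trans (X^-assoc 1 n _) (X^-coeff-≢ (ℕ.>⇒≢ (ℕ.≤-<-trans (ℕ.≤-reflexive (ℕ.*-identityˡ n)) n<k)))))
    (+-identityˡ _)

  X^-1-⊛-∑X^ : ∀ m n → (X ⊛^ m ⊖ 𝟏) ⊛ ∑X^ m n ≐ X ⊛^ (m ℕ.* n) ⊖ 𝟏
  X^-1-⊛-∑X^ m n = K⟦x⟧.trans (telescope (X ⊛^ m) n) (K⟦x⟧.+-congʳ (X^-assoc m n))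

-- Divisibility, representable exponents and gaps of sorted lists.

module Arithmetic where

  open import Data.Nat.Base using (_+_; _*_; _∸_; _^_; _≥_; >-nonZero; nonTrivial⇒n>1)
  open import Data.Nat.Properties
  open import Relation.Binary.PropositionalEquality using (refl; sym; trans; cong; subst; subst₂)

  1<prime : ∀ {p} → Prime p → 1 < p
  1<prime prime-p = nonTrivial⇒n>1 _ {{prime⇒nonTrivial prime-p}}

  0<prime : ∀ {p} → Prime p → 0 < p
  0<prime prime-p = <⇒≤ (1<prime prime-p)

  prime-∣-prime : ∀ {p q} → Prime p → Prime q → p ∣ q → p ≡ q
  prime-∣-prime prime-p prime-q p∣q with prime⇒irreducible prime-q p∣q
  ... | inj₁ refl = contradiction prime-p ¬prime[1]
  ... | inj₂ p≡q  = p≡q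

  ∣-*-prime : ∀ {m p j} → Prime p → p ∤ m → m ∣ j → p ∣ j → m * p ∣ j
  ∣-*-prime {m} {p} prime-p p∤m (divides a refl) p∣j with euclidsLemma a m prime-p p∣j
  ... | inj₁ p∣a = subst (_∣ a * m) (*-comm p m) (*-monoˡ-∣ m p∣a)
  ... | inj₂ p∣m = contradiction p∣m p∤m

  does-*-prime : ∀ m {p} → Prime p → p ∤ m → ∀ j → does (m * p ∣? j) ≡ does (m ∣? j) ∧ does (p ∣? j)
  does-*-prime m {p} prime-p p∤m j = does-⇔ (mk⇔
    (λ mp∣j → ∣-trans (m∣m*n p) mp∣j , ∣-trans (n∣m*n m) mp∣j)
    (λ (m∣j , p∣j) → ∣-*-prime prime-p p∤m m∣j p∣j)) (m * p ∣? j) (m ∣? j ×-dec p ∣? j)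

  prime-divisor : ∀ n → 1 < n → ∃[ p ] Prime p × p ∣ n
  prime-divisor n 1<n with factorise n {{>-nonZero (<⇒≤ 1<n)}}
  ... | record { factors = []; isFactorisation = n≡1 } = contradiction n≡1 (>⇒≢ 1<n)
  ... | record { factors = p ∷ ps; isFactorisation = n≡∏; factorsPrime = prime-p ∷ _ } =
    p , prime-p , subst (p ∣_) (sym n≡∏) (m∣m*n _)

  module _ {p q r} (prime-p : Prime p) (prime-q : Prime q) (prime-r : Prime r) where

    n≢0 : p * q * r ≢ 0
    n≢0 = >⇒≢ (*-mono-< (*-mono-< (0<prime prime-p) (0<prime prime-q)) (0<prime prime-r))

    -- A gcd greater than 1 has a prime divisor, which divides pqr and hence is one of the three
    -- primes.
    1<gcd⇔ : ∀ j → 1 < gcd j (p * q * r) ⇔ (p ∣ j ⊎ q ∣ j ⊎ r ∣ j)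
    1<gcd⇔ j = mk⇔ to [ from prime-p p∣n , [ from prime-q q∣n , from prime-r (n∣m*n (p * q)) ]′ ]′
      where
      p∣n : p ∣ p * q * r
      p∣n = ∣-trans (m∣m*n q) (m∣m*n r)
      q∣n : q ∣ p * q * r
      q∣n = ∣-trans (n∣m*n p) (m∣m*n r)
      from : ∀ {s} → Prime s → s ∣ p * q * r → s ∣ j → 1 < gcd j (p * q * r)
      from prime-s s∣n s∣j = ≤-trans (1<prime prime-s)
        (∣⇒≤ {{>-nonZero (n≢0⇒n>0 (gcd[m,n]≢0 j _ (inj₂ n≢0)))}} (gcd-greatest s∣j s∣n))
      to : 1 < gcd j (p * q * r) → p ∣ j ⊎ q ∣ j ⊎ r ∣ j
      to 1<g with prime-divisor _ 1<g
      ... | s , prime-s , s∣g with euclidsLemma (p * q) r prime-s (∣-trans s∣g (gcd[m,n]∣n j _))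
      ...   | inj₂ s∣r = inj₂ (inj₂ (subst (_∣ j) (prime-∣-prime prime-s prime-r s∣r) (∣-trans s∣g (gcd[m,n]∣m j _))))
      ...   | inj₁ s∣pq with euclidsLemma p q prime-s s∣pq
      ...     | inj₁ s∣p = inj₁ (subst (_∣ j) (prime-∣-prime prime-s prime-p s∣p) (∣-trans s∣g (gcd[m,n]∣m j _)))
      ...     | inj₂ s∣q = inj₂ (inj₁ (subst (_∣ j) (prime-∣-prime prime-s prime-q s∣q) (∣-trans s∣g (gcd[m,n]∣m j _))))

    does-1<gcd : ∀ j → does (1 <? gcd j (p * q * r)) ≡ does (p ∣? j) ∨ does (q ∣? j) ∨ does (r ∣? j)
    does-1<gcd j = does-⇔ (1<gcd⇔ j) (1 <? _) (p ∣? j ⊎-dec q ∣? j ⊎-dec r ∣? j)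

  -- When the window moves by one, it loses its multiple of `p` only at the left end, and then the
  -- next multiple enters at the right end.
  multiple-between : ∀ {p} → 0 < p → ∀ t → ∃[ v ] t ≤ p * v × p * v < t + p
  multiple-between {p} 0<p zero    = 0 , z≤n , subst (_< p) (sym (*-zeroʳ p)) 0<p
  multiple-between {p} 0<p (suc t) with multiple-between 0<p t
  ... | v , t≤pv , pv<t+p with suc t ≤? p * v
  ...   | yes t<pv = v , t<pv , m<n⇒m<1+n pv<t+p
  ...   | no  t≮pv = suc v , ≤-trans (+-mono-≤ 0<p t≤pv) (≤-reflexive (sym (*-suc p v)))
                   , s≤s (≤-trans (≤-reflexive (*-suc p v)) (≤-trans (+-monoʳ-≤ p (≮⇒≥ t≮pv)) (≤-reflexive (+-comm p t))))

  -- The exponents p v + q u with v < r and u < p meet every window of length p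
  -- up to their maximum: those with u = 0 below p r, those with u = p − 1 above.
  hits-window : ∀ {p q r} → 0 < p → q < r → ∀ m →
    m + p ≤ p * r + (p ∸ 1) * q → ∃[ v ] ∃[ u ] v < r × u < p × m ≤ p * v + q * u × p * v + q * u < m + p
  hits-window {suc p′} {q} {r} 0<p q<r m m+p≤ with m + suc p′ ≤? suc p′ * r
  ... | yes m+p≤pr with multiple-between 0<p m
  ...   | v , m≤pv , pv<m+p = v , 0
        , *-cancelˡ-< (suc p′) v r (<-≤-trans pv<m+p m+p≤pr) , 0<p
        , subst (m ≤_) (sym eq) m≤pv , subst (_< m + suc p′) (sym eq) pv<m+p
    where
    eq : suc p′ * v + q * 0 ≡ suc p′ * v
    eq = trans (cong (suc p′ * v +_) (*-zeroʳ q)) (+-identityʳ _)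
  hits-window {suc p′} {q} {r} 0<p q<r m m+p≤ | no m+p≰pr with m≤n⇒∃[o]m+o≡n p′q≤m
    where
    -- A window that reaches past pr starts no earlier than (p - 1)q: since q < r, (p - 1)q + p ≤
    -- p(q + 1) ≤ pr. Subtracting (p - 1)q from it leaves a window for multiples of p alone, and the
    -- bound on `m + p` becomes `v < r`.
    p′q≤m : q * p′ ≤ m
    p′q≤m = +-cancelʳ-≤ (suc p′) _ _ (≤-trans (begin
      q * p′ + suc p′        ≤⟨ m≤n+m _ q ⟩
      q + (q * p′ + suc p′)  ≡⟨ rearrange q p′ ⟩
      suc p′ * suc q         ≤⟨ *-monoʳ-≤ (suc p′) q<r ⟩
      suc p′ * r             ∎) (<⇒≤ (≰⇒> m+p≰pr)))
      where
      open ≤-Reasoning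
      rearrange : ∀ q p′ → q + (q * p′ + suc p′) ≡ suc p′ * suc q
      rearrange = solve-∀
  ... | t , refl with multiple-between 0<p t
  ...   | v , t≤pv , pv<t+p = v , p′
        , *-cancelˡ-< (suc p′) v r (<-≤-trans pv<t+p (+-cancelˡ-≤ (q * p′) _ _
            (≤-trans (≤-reflexive (sym (+-assoc (q * p′) t (suc p′)))) (≤-trans m+p≤
              (≤-reflexive (trans (+-comm (suc p′ * r) _) (cong (_+ suc p′ * r) (*-comm p′ q))))))))
        , ≤-refl
        , subst (q * p′ + t ≤_) (+-comm (q * p′) _) (+-monoʳ-≤ (q * p′) t≤pv)
        , subst₂ _<_ (+-comm (q * p′) _) (sym (+-assoc (q * p′) t (suc p′))) (+-monoʳ-< (q * p′) pv<t+p)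

  -- The left side is deg A + p + r - 1 by `D+p+r≡`. In the first case q < r bounds it by (2p - 1)r,
  -- and 2p - 1 ≤ 4(p - 1) ≤ q as p ≥ 2. In the second, with q = p + 1 + k, what remains to be shown
  -- is (p - 1)q ≤ (k + 1)r, and (k + 1)p² already exceeds (p - 1)q.
  slack : ∀ {p q r} → 1 < p → p < q → q < r → (q ≥ 4 * (p ∸ 1)) ⊎ (r ≥ p ^ 2) →
    p * r + (p ∸ 1) * q ≤ q * r
  slack {1} (s<s ())
  slack {suc p′@(suc p″)} {q} {r} _ p<q q<r (inj₁ q≥4p′) = begin
    suc p′ * r + p′ * q    ≤⟨ +-monoʳ-≤ (suc p′ * r) (*-monoʳ-≤ p′ (<⇒≤ q<r)) ⟩
    suc p′ * r + p′ * r    ≡⟨ *-distribʳ-+ r (suc p′) p′ ⟨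
    (suc p′ + p′) * r      ≤⟨ *-monoˡ-≤ r (≤-trans (bound p″) q≥4p′) ⟩
    q * r                  ∎
    where
    open ≤-Reasoning
    bound : ∀ k → suc (suc k) + suc k ≤ 4 * suc k
    bound k = ≤-trans (m≤m+n _ (1 + 2 * k)) (≤-reflexive (eq k))
      where
      eq : ∀ k → suc (suc k) + suc k + (1 + 2 * k) ≡ 4 * suc k
      eq = solve-∀
  slack {suc p′} {q} {r} _ p<q q<r (inj₂ r≥p²) with m≤n⇒∃[o]m+o≡n p<q
  ... | k , refl = begin
    suc p′ * r + p′ * (suc (suc p′) + k)    ≤⟨ +-monoʳ-≤ (suc p′ * r) (m≤m+n _ _) ⟩
    -- The added term is the exact difference (k + 1)p² - (p - 1)q for q = p + 1 + k.
    suc p′ * r + (p′ * (suc (suc p′) + k) + (1 + k * (suc p′ + p′ * p′))) ≡⟨ cong (suc p′ * r +_) (eq p′ k) ⟩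
    suc p′ * r + suc k * (suc p′ ^ 2)       ≤⟨ +-monoʳ-≤ (suc p′ * r) (*-monoʳ-≤ (suc k) r≥p²) ⟩
    suc p′ * r + suc k * r                  ≡⟨ *-distribʳ-+ r (suc p′) (suc k) ⟨
    (suc p′ + suc k) * r                    ≡⟨ cong (_* r) (+-suc (suc p′) k) ⟩
    (suc (suc p′) + k) * r                  ∎
    where
    open ≤-Reasoning
    eq : ∀ p′ k → p′ * (suc (suc p′) + k) + (1 + k * (suc p′ + p′ * p′)) ≡ suc k * (suc p′ * (suc p′ * 1))
    eq = solve-∀

  Consecutive : List ℕ → ℕ → ℕ → Set
  Consecutive xs d e = d ∈ xs × e ∈ xs × d < e × (∀ {k} → k ∈ xs → k ≤ d ⊎ e ≤ k)

  gaps-consecutive : ∀ {xs} → AllPairs _<_ xs → All (λ g → ∃[ d ] ∃[ e ] g ≡ e ∸ d × Consecutive xs d e) (gaps xs)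
  gaps-consecutive []                 = []
  gaps-consecutive ([] ∷ [])          = []
  gaps-consecutive {d ∷ e ∷ xs} ((d<e ∷ d<xs) ∷ e<xs ∷ sorted) =
    (d , e , refl , here refl , there (here refl) , d<e , split)
    ∷ All.map extend (gaps-consecutive (e<xs ∷ sorted))
    where
    split : ∀ {k} → k ∈ d ∷ e ∷ xs → k ≤ d ⊎ e ≤ k
    split (here refl)         = inj₁ ≤-refl
    split (there (here refl)) = inj₂ ≤-refl
    split (there (there k∈))  = inj₂ (<⇒≤ (All.lookup e<xs k∈))
    extend : ∀ {g} → (∃[ d′ ] ∃[ e′ ] g ≡ e′ ∸ d′ × Consecutive (e ∷ xs) d′ e′) →
      ∃[ d′ ] ∃[ e′ ] g ≡ e′ ∸ d′ × Consecutive (d ∷ e ∷ xs) d′ e′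
    extend (d′ , e′ , g≡ , d′∈ , e′∈ , d′<e′ , split′) = d′ , e′ , g≡ , there d′∈ , there e′∈ , d′<e′ ,
      λ { (here refl) → inj₁ (<⇒≤ (All.lookup (d<e ∷ d<xs) d′∈)) ; (there k∈) → split′ k∈ }

  consecutive-gap : ∀ {xs d e} → AllPairs _<_ xs → Consecutive xs d e → e ∸ d ∈ gaps xs
  consecutive-gap (x<xs ∷ _) (here refl , here refl , d<e , _) = contradiction d<e (<-irrefl refl)
  consecutive-gap (x<xs ∷ _) (there d∈ , here refl , d<e , _) = contradiction d<e (<-asym (All.lookup x<xs d∈))
  consecutive-gap {xs = d ∷ y ∷ xs} ((d<y ∷ _) ∷ y<xs ∷ _) (here refl , there e∈ , d<e , split)
    with e∈ | split (there (here refl))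
  ... | here refl | _        = here refl
  ... | there _   | inj₁ y≤d = contradiction d<y (≤⇒≯ y≤d)
  ... | there e∈′ | inj₂ e≤y = contradiction (All.lookup y<xs e∈′) (≤⇒≯ e≤y)
  consecutive-gap {xs = x ∷ y ∷ xs} (_ ∷ sorted) (there d∈ , there e∈ , d<e , split) =
    there (consecutive-gap sorted (d∈ , e∈ , d<e , λ k∈ → split (there k∈)))

  max-gap≡ : ∀ {xs d e} → AllPairs _<_ xs → Consecutive xs d e →
    (∀ {d′ e′} → Consecutive xs d′ e′ → e′ ∸ d′ ≤ e ∸ d) → max 0 (gaps xs) ≡ e ∸ d
  max-gap≡ sorted consecutive largest = ≤-antisym
    (max≤v⁺ z≤n (All.map (λ { (_ , _ , refl , c) → largest c }) (gaps-consecutive sorted)))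
    (v≤max⁺ 0 _ (inj₂ (Any.map ≤-reflexive (consecutive-gap sorted consecutive))))

  -- The second hypothesis says p + r - 1 ≤ Q - D, so a gap strictly longer than Q - D has length at
  -- least p + r; the successor in the hypothesis is matched by the strict inequality.
  gap-length : ∀ {D Q p r d e} → D < Q → D + p + r ≤ suc Q → Q ∸ D < e ∸ d → d + r + p ≤ e
  gap-length {D} {Q} {p} {r} {d} {e} D<Q D+p+r≤ gap< = begin
    d + r + p        ≡⟨ trans (+-assoc d r p) (cong (d +_) (+-comm r p)) ⟩
    d + (p + r)      ≤⟨ +-monoʳ-≤ d (≤-trans p+r≤ gap<) ⟩
    d + (e ∸ d)      ≡⟨ m+[n∸m]≡n (<⇒≤ (m∸n≢0⇒n<m {e} {d} (>⇒≢ (≤-<-trans z≤n gap<)))) ⟩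
    e                    ∎
    where
    open ≤-Reasoning
    p+r≤ : p + r ≤ suc (Q ∸ D)
    p+r≤ = +-cancelˡ-≤ D _ _ (begin
      D + (p + r)        ≡⟨ +-assoc D p r ⟨
      D + p + r          ≤⟨ D+p+r≤ ⟩
      suc Q                  ≡⟨ cong suc (m+[n∸m]≡n (<⇒≤ D<Q)) ⟨
      suc (D + (Q ∸ D))  ≡⟨ +-suc D (Q ∸ D) ⟨
      D + suc (Q ∸ D)    ∎)

  -- With D = deg A and Q = qr, this keeps the two copies of A in Ψ_n from overlapping.
  bound⇒D<Q : ∀ {D Q p r} → 1 < p → 0 < r → D + p + r ≤ suc Q → D < Q
  bound⇒D<Q {D} {Q} {p} {r} 1<p 0<r D+p+r≤ = s≤s⁻¹ (begin
    suc (suc D)      ≡⟨ +-comm 2 D ⟩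
    D + 2          ≤⟨ +-monoʳ-≤ D 1<p ⟩
    D + p          ≤⟨ m≤m+n _ r ⟩
    D + p + r    ≤⟨ D+p+r≤ ⟩
    suc Q            ∎)
    where open ≤-Reasoning

open Arithmetic

-- Coefficient lists as power series.

module Polynomials {c ℓ₁ ℓ₂} (K : HeytingField c ℓ₁ ℓ₂) where

  open HeytingField K using (heytingCommutativeRing)
  open HeytingCommutativeRing heytingCommutativeRing using (commutativeRing)
  open CommutativeRing commutativeRing
  open RingProperties ring
  open PowerSeries commutativeRing
  open LinearFactors commutativeRing
  open RangeProduct (CommutativeRing.*-commutativeMonoid ring⟦x⟧)

  coeff-⊞ : ∀ f g → coeff K (_⊞_ K f g) ≐ coeff K f ⊕ coeff K g
  coeff-⊞ []      g       k       = sym (+-identityˡ _)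
  coeff-⊞ (a ∷ f) []      k       = sym (+-identityʳ _)
  coeff-⊞ (a ∷ f) (b ∷ g) zero    = refl
  coeff-⊞ (a ∷ f) (b ∷ g) (suc k) = coeff-⊞ f g k

  coeff-map : ∀ a f k → coeff K (map (a *_) f) k ≈ a * coeff K f k
  coeff-map a []      k       = sym (zeroʳ a)
  coeff-map a (b ∷ f) zero    = refl
  coeff-map a (b ∷ f) (suc k) = coeff-map a f k

  coeff-⊠ : ∀ f g → coeff K (_⊠_ K f g) ≐ coeff K f ⊛ coeff K g
  coeff-⊠ []      g k = sym (⊛-vanishes (coeff K []) (coeff K g) k (λ _ _ _ → zeroˡ _))
  coeff-⊠ (a ∷ f) g k = trans (coeff-⊞ (map (a *_) g) (0# ∷ _⊠_ K f g) k) (trans (+-congʳ (coeff-map a g k)) (step k))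
    where
    step : ∀ k → a * coeff K g k + coeff K (0# ∷ _⊠_ K f g) k ≈ (coeff K (a ∷ f) ⊛ coeff K g) k
    step zero    = +-identityʳ _
    step (suc k) = +-congˡ (coeff-⊠ f g k)

  coeff-1 : coeff K (1# ∷ []) ≐ 𝟏
  coeff-1 zero    = refl
  coeff-1 (suc k) = refl

  coeff-X- : ∀ a → coeff K (X-_ K a) ≐ X⊖ a
  coeff-X- a zero          = sym (+-identityˡ _)
  coeff-X- a (suc zero)    = sym (trans (+-congˡ -0#≈0#) (+-identityʳ _))
  coeff-X- a (suc (suc k)) = sym (trans (+-congˡ -0#≈0#) (+-identityʳ _))

  -- The index map `f` is arbitrary because the induction replaces it by its shift; for `Ψ` it is
  -- the identity.
  coeff-product : ∀ {ℓ} {P : U.Pred ℕ ℓ} (P? : U.Decidable P) (root : ℕ → Carrier) (f : ℕ → ℕ) n →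
    coeff K (foldr (_⊠_ K) (1# ∷ []) (map (λ j → X-_ K (root j)) (filter P? (map suc (applyUpTo f n)))))
      ≐ ∏ (λ i → X⊖ (root (suc (f i))) when does (P? (suc (f i)))) n
  coeff-product P? root f zero    = coeff-1
  coeff-product P? root f (suc n) with P? (suc (f 0))
  ... | true because _ = K⟦x⟧.trans (coeff-⊠ (X-_ K (root (suc (f 0))))
      (foldr (_⊠_ K) (1# ∷ []) (map (λ j → X-_ K (root j)) (filter P? (map suc (applyUpTo (λ i → f (suc i)) n))))))
    (K⟦x⟧.*-cong (coeff-X- _) (coeff-product P? root (λ i → f (suc i)) n))
  ... | false because _ = K⟦x⟧.trans (coeff-product P? root (λ i → f (suc i)) n) (K⟦x⟧.sym (K⟦x⟧.*-identityˡ _))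

-- The factor A of Ψ_n: its equation, degree, integrality and gaps.

module InverseCyclotomic
  {c ℓ₁ ℓ₂} (K : HeytingField c ℓ₁ ℓ₂) (char0 : CharacteristicZero K)
  {p q r} (prime-p : Prime p) (prime-q : Prime q) (prime-r : Prime r) (p<q : p < q) (q<r : q < r)
  (ζ : HeytingField.Carrier K) (ζ-primitive : PrimitiveRoot K (p ℕ.* q ℕ.* r) ζ) where

  open HeytingField K using (_#_; heytingCommutativeRing; #-irrefl; #-sym; #⇒invertible; invertible⇒#)
  open HeytingCommutativeRing heytingCommutativeRing using (commutativeRing)
  open HeytingProperties heytingCommutativeRing
  open CommutativeRing commutativeRing
  open RingProperties ring
  open Exp semiring
  open Mult semiring using (×-homo-+) renaming (_×_ to _·_)
  open PowerSeries commutativeRing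
  open LinearFactors commutativeRing
  open IntegerElements commutativeRing
  open Polynomials K
  open RangeProduct K⟦x⟧.*-commutativeMonoid
  open PrimitiveRoot ζ-primitive

  n : ℕ
  n = p ℕ.* q ℕ.* r

  0<p : 0 < p
  0<p = 0<prime prime-p
  0<q : 0 < q
  0<q = 0<prime prime-q
  0<r : 0 < r
  0<r = 0<prime prime-r

  -- For an integer i - j the comparison of i with j settles the matter: a difference i ≠ j is, up
  -- to sign, a positive multiple of 1, which characteristic 0 makes apart from 0.
  integer-dichotomy : ∀ {a} → IsInteger a → a # 0# ⊎ a ≈ 0#
  integer-dichotomy {a} (i , j , a≈) with ℕ.<-cmp i j
  ... | tri≈ _ ≡.refl _ = inj₂ (trans a≈ (-‿inverseʳ _))
  ... | tri> _ _ j<i with ℕ.m≤n⇒∃[o]m+o≡n j<i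
  ...   | k , ≡.refl = inj₁ (#-congʳ (sym (trans a≈ (begin
    (suc j ℕ.+ k) · 1# - j · 1#          ≡⟨ ≡.cong (λ l → l · 1# - j · 1#) (≡.sym (ℕ.+-suc j k)) ⟩
    (j ℕ.+ suc k) · 1# - j · 1#          ≈⟨ +-congʳ (×-homo-+ 1# j (suc k)) ⟩
    j · 1# + suc k · 1# - j · 1#         ≈⟨ xyx⁻¹≈y _ _ ⟩
    suc k · 1#                           ∎))) (char0 k))
    where open SetoidReasoning setoid
  integer-dichotomy {a} (i , j , a≈) | tri< i<j _ _ with ℕ.m≤n⇒∃[o]m+o≡n i<j
  -- For negative a, apartness is carried over from `suc k · 1#` through invertibility, as
  -- `suc k · 1# - 0#` equals `0# - a`.
  ...   | k , ≡.refl = inj₁ (#-sym (invertible⇒# (invertible-respects (#⇒invertible (char0 k)))))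
    where
    open SetoidReasoning setoid
    difference : suc k · 1# - 0# ≈ 0# - a
    difference = begin
      suc k · 1# - 0#                            ≈⟨ x-0≈x _ ⟩
      suc k · 1#                                 ≈⟨ xyx⁻¹≈y _ _ ⟨
      i · 1# + suc k · 1# - i · 1#               ≈⟨ +-congʳ (×-homo-+ 1# i (suc k)) ⟨
      (i ℕ.+ suc k) · 1# - i · 1#                ≡⟨ ≡.cong (λ l → l · 1# - i · 1#) (ℕ.+-suc i k) ⟩
      (suc i ℕ.+ k) · 1# - i · 1#                ≈⟨ ⁻¹-anti-homo‿- _ _ ⟨
      - (i · 1# - (suc i ℕ.+ k) · 1#)            ≈⟨ -‿cong a≈ ⟨
      - a                                        ≈⟨ +-identityˡ _ ⟨
      0# - a                                     ∎
    invertible-respects : Invertible _≈_ 1# _*_ (suc k · 1# - 0#) → Invertible _≈_ 1# _*_ (0# - a)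
    invertible-respects (b , bx≈1 , xb≈1) =
      b , trans (*-congˡ (sym difference)) bx≈1 , trans (*-congʳ (sym difference)) xb≈1

  -- Here (w - 1)x = 0, and w - 1 is invertible.
  torsionfree : ∀ {w x} → w # 1# → w * x ≈ x → x ≈ 0#
  torsionfree {w} {x} w#1 wx≈x with #⇒invertible w#1
  ... | b , b[w-1]≈1 , _ = begin
    x                     ≈⟨ *-identityˡ x ⟨
    1# * x                ≈⟨ *-congʳ b[w-1]≈1 ⟨
    b * (w - 1#) * x      ≈⟨ *-assoc _ _ _ ⟩
    b * ((w - 1#) * x)    ≈⟨ *-congˡ ([y-z]x≈yx-zx x w 1#) ⟩
    b * (w * x - 1# * x)  ≈⟨ *-congˡ (x≈y⇒x∙y⁻¹≈ε (trans wx≈x (sym (*-identityˡ x)))) ⟩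
    b * 0#                ≈⟨ zeroʳ b ⟩
    0#                    ∎
    where open SetoidReasoning setoid

  selected : (ℕ → Bool) → Series
  selected b = ∏ (λ i → X⊖ (ζ ^ suc i) when b (suc i)) n

  selected-cong : ∀ {b b′} → (∀ j → b j ≡ b′ j) → selected b ≐ selected b′
  selected-cong b≡b′ = ∏-cong (λ i → K⟦x⟧.reflexive (≡.cong (X⊖ (ζ ^ suc i) when_) (b≡b′ (suc i)))) n

  -- The multiples of d up to n are d, 2d, ..., md, and ζ^d is a primitive m-th root of unity: for 0
  -- < k < m the exponent kd stays below n, where `order` applies.
  multiples : ∀ {d} m → 0 < d → 0 < m → m ℕ.* d ≡ n → selected (λ j → does (d ∣? j)) ≐ X ⊛^ m ⊖ 𝟏
  multiples {d} (suc m) 0<d _ md≡n = K⟦x⟧.trans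
    (K⟦x⟧.reflexive (≡.cong (∏ (λ i → X⊖ (ζ ^ suc i) when does (d ∣? suc i))) (≡.sym md≡n)))
    (K⟦x⟧.trans (∏-multiples (λ j → X⊖ (ζ ^ j)) 0<d (suc m))
    (K⟦x⟧.trans (∏-cong (λ i → X⊖-cong (powers (suc i))) (suc m))
    (product-roots-of-unity (ζ ^ d) m (trans (sym (powers (suc m))) (trans (reflexive (≡.cong (ζ ^_) md≡n)) root))
      λ {k} 0<k k<m _ → torsionfree (#-congʳ (powers k) (order (ℕ.*-mono-< 0<k 0<d)
        (ℕ.<-≤-trans (ℕ.*-monoˡ-< d {{ℕ.>-nonZero 0<d}} k<m) (ℕ.≤-reflexive md≡n)))))))
    where
    powers : ∀ k → ζ ^ (k ℕ.* d) ≈ (ζ ^ d) ^ k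
    powers k = trans (reflexive (≡.cong (ζ ^_) (ℕ.*-comm k d))) (sym (^-assocʳ ζ d k))

  [_∣] : ℕ → ℕ → Bool
  [ d ∣] j = does (d ∣? j)

  -- Its roots are the powers of ζ of order p, pq or pr, so this is Φ_p Φ_pq Φ_pr.
  A : Series
  A = selected (λ j → not ([ p ∣] j) ∧ ([ q ∣] j ∨ [ r ∣] j))

  x^_−1 : ℕ → Series
  x^ m −1 = X ⊛^ m ⊖ 𝟏

  ψ : Series
  ψ = coeff K (Ψ K n ζ)

  ψ≐ : ψ ≐ x^ (q ℕ.* r) −1 ⊛ A
  ψ≐ = begin
    ψ
      ≈⟨ coeff-product (λ j → 1 ℕ.<? gcd j n) (ζ ^_) (λ i → i) n ⟩
    selected (λ j → does (1 ℕ.<? gcd j n))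
      ≈⟨ selected-cong (does-1<gcd prime-p prime-q prime-r) ⟩
    selected (λ j → [ p ∣] j ∨ [ q ∣] j ∨ [ r ∣] j)
      ≈⟨ ∏-cong (λ i → remove-multiples (X⊖ (ζ ^ suc i)) ([ p ∣] (suc i)) ([ q ∣] (suc i)) ([ r ∣] (suc i))) n ⟩
    ∏ (λ i → _ ⊛ _) n
      ≈⟨ ∏-∙ _ _ n ⟨
    selected [ p ∣] ⊛ A
      ≈⟨ K⟦x⟧.*-congʳ (multiples (q ℕ.* r) 0<p (ℕ.*-mono-< 0<q 0<r) (rearrange p q r)) ⟩
    x^ (q ℕ.* r) −1 ⊛ A ∎
    where
    open SetoidReasoning K⟦x⟧.setoid
    rearrange : ∀ p q r → q ℕ.* r ℕ.* p ≡ p ℕ.* q ℕ.* r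
    rearrange = solve-∀

  -- The three factors next to A are products over the indices divisible by two of the primes: qr
  -- gives x^p - 1, pq gives x^r - 1 and pr gives x^q - 1. On the right, the only index divisible by
  -- all three is n itself, whence x - 1.
  A-equation : A ⊛ x^ p −1 ⊛ x^ r −1 ⊛ x^ q −1 ≐ x^ (p ℕ.* r) −1 ⊛ x^ (q ℕ.* p) −1 ⊛ x^ 1 −1
  A-equation = begin
    A ⊛ x^ p −1 ⊛ x^ r −1 ⊛ x^ q −1
      ≈⟨ K⟦x⟧.*-cong (K⟦x⟧.*-cong (K⟦x⟧.*-congˡ {A}
           (both q r p prime-r (distinct prime-r prime-q q<r) 0<q (rearrange₁ p q r)))
           (both p q r prime-q (distinct prime-q prime-p p<q) 0<p (rearrange₂ p q r)))
           (both p r q prime-r (distinct prime-r prime-p (ℕ.<-trans p<q q<r)) 0<p (rearrange₃ p q r)) ⟨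
    A ⊛ selected (λ j → [ q ∣] j ∧ [ r ∣] j) ⊛ selected (λ j → [ p ∣] j ∧ [ q ∣] j) ⊛ selected (λ j → [ p ∣] j ∧ [ r ∣] j)
      ≈⟨ K⟦x⟧.trans (K⟦x⟧.*-congʳ (K⟦x⟧.trans (K⟦x⟧.*-congʳ (∏-∙ _ _ n)) (∏-∙ _ _ n))) (∏-∙ _ _ n) ⟩
    ∏ _ n
      ≈⟨ ∏-cong (λ i → inclusion-exclusion (X⊖ (ζ ^ suc i)) ([ p ∣] (suc i)) ([ q ∣] (suc i)) ([ r ∣] (suc i))) n ⟩
    ∏ _ n
      ≈⟨ K⟦x⟧.trans (K⟦x⟧.*-congʳ (∏-∙ _ _ n)) (∏-∙ _ _ n) ⟨
    selected [ q ∣] ⊛ selected [ r ∣] ⊛ selected (λ j → [ p ∣] j ∧ [ q ∣] j ∧ [ r ∣] j)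
      ≈⟨ K⟦x⟧.*-cong (K⟦x⟧.*-cong
           (multiples (p ℕ.* r) 0<q (ℕ.*-mono-< 0<p 0<r) (rearrange₄ p q r))
           (multiples (q ℕ.* p) 0<r (ℕ.*-mono-< 0<q 0<p) (rearrange₅ p q r))) all-three ⟩
    x^ (p ℕ.* r) −1 ⊛ x^ (q ℕ.* p) −1 ⊛ x^ 1 −1 ∎
    where
    open SetoidReasoning K⟦x⟧.setoid
    rearrange₁ : ∀ p q r → p ℕ.* (q ℕ.* r) ≡ p ℕ.* q ℕ.* r
    rearrange₁ = solve-∀
    rearrange₂ : ∀ p q r → r ℕ.* (p ℕ.* q) ≡ p ℕ.* q ℕ.* r
    rearrange₂ = solve-∀
    rearrange₃ : ∀ p q r → q ℕ.* (p ℕ.* r) ≡ p ℕ.* q ℕ.* r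
    rearrange₃ = solve-∀
    rearrange₄ : ∀ p q r → p ℕ.* r ℕ.* q ≡ p ℕ.* q ℕ.* r
    rearrange₄ = solve-∀
    rearrange₅ : ∀ p q r → q ℕ.* p ℕ.* r ≡ p ℕ.* q ℕ.* r
    rearrange₅ = solve-∀
    distinct : ∀ {s t} → Prime s → Prime t → t < s → s ∤ t
    distinct prime-s prime-t t<s s∣t = ℕ.<-irrefl (≡.sym (prime-∣-prime prime-s prime-t s∣t)) t<s
    both : ∀ s t m → Prime t → t ∤ s → 0 < s → m ℕ.* (s ℕ.* t) ≡ n →
      selected (λ j → [ s ∣] j ∧ [ t ∣] j) ≐ x^ m −1
    both s t zero prime-t t∤s 0<s eq = contradiction (≡.sym eq) (n≢0 prime-p prime-q prime-r)
    both s t m@(suc _) prime-t t∤s 0<s eq = K⟦x⟧.trans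
      (selected-cong (λ j → ≡.sym (does-*-prime s prime-t t∤s j)))
      (multiples m (ℕ.*-mono-< 0<s (0<prime prime-t)) z<s eq)
    pq∤ : r ∤ p ℕ.* q
    pq∤ r∣pq with euclidsLemma p q prime-r r∣pq
    ... | inj₁ r∣p = distinct prime-r prime-p (ℕ.<-trans p<q q<r) r∣p
    ... | inj₂ r∣q = distinct prime-r prime-q q<r r∣q
    all-three : selected (λ j → [ p ∣] j ∧ [ q ∣] j ∧ [ r ∣] j) ≐ x^ 1 −1
    all-three = K⟦x⟧.trans (selected-cong (λ j → ≡.trans (≡.sym (∧-assoc ([ p ∣] j) _ _))
      (≡.cong (_∧ [ r ∣] j) (≡.sym (does-*-prime p prime-q (distinct prime-q prime-p p<q) j)))))
      (both (p ℕ.* q) r 1 prime-r pq∤ (ℕ.*-mono-< 0<p 0<q) (ℕ.*-identityˡ n))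

  -- Multiplied by (x - 1)(x^p - 1)(x^q - 1), which can be cancelled, the geometric sums telescope
  -- and the claim becomes `A-equation`.
  A-summed : A ⊛ ∑X^ 1 r ≐ ∑X^ p r ⊛ ∑X^ q p
  A-summed = X^-1-cancelʳ {1} z<s (X^-1-cancelʳ 0<p (X^-1-cancelʳ 0<q (begin
    A ⊛ S ⊛ x^ 1 −1 ⊛ x^ p −1 ⊛ x^ q −1
      ≈⟨ solve 5 (λ a s x y z → (((a ∙ s) ∙ x) ∙ y) ∙ z ⊜ ((a ∙ y) ∙ (x ∙ s)) ∙ z) K⟦x⟧.refl A S (x^ 1 −1) (x^ p −1) (x^ q −1) ⟩
    A ⊛ x^ p −1 ⊛ (x^ 1 −1 ⊛ S) ⊛ x^ q −1
      ≈⟨ K⟦x⟧.*-congʳ (K⟦x⟧.*-congˡ {A ⊛ x^ p −1} (K⟦x⟧.trans (X^-1-⊛-∑X^ 1 r)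
           (K⟦x⟧.reflexive (≡.cong x^_−1 (ℕ.*-identityˡ r))))) ⟩
    A ⊛ x^ p −1 ⊛ x^ r −1 ⊛ x^ q −1
      ≈⟨ A-equation ⟩
    x^ (p ℕ.* r) −1 ⊛ x^ (q ℕ.* p) −1 ⊛ x^ 1 −1
      ≈⟨ K⟦x⟧.*-congʳ (K⟦x⟧.*-cong (X^-1-⊛-∑X^ p r) (X^-1-⊛-∑X^ q p)) ⟨
    x^ p −1 ⊛ ∑X^ p r ⊛ (x^ q −1 ⊛ ∑X^ q p) ⊛ x^ 1 −1
      ≈⟨ solve 5 (λ y s z t x → ((y ∙ s) ∙ (z ∙ t)) ∙ x ⊜ (((s ∙ t) ∙ x) ∙ y) ∙ z) K⟦x⟧.refl
           (x^ p −1) (∑X^ p r) (x^ q −1) (∑X^ q p) (x^ 1 −1) ⟩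
    ∑X^ p r ⊛ ∑X^ q p ⊛ x^ 1 −1 ⊛ x^ p −1 ⊛ x^ q −1 ∎)))
    where
    open SetoidReasoning K⟦x⟧.setoid
    open MonoidSolver K⟦x⟧.*-commutativeMonoid using (solve; _⊜_) renaming (_⊕_ to _∙_)
    S : Series
    S = ∑X^ 1 r

  1≉0 : ¬ 1# ≈ 0#
  1≉0 1≈0 = #-irrefl 1≈0 1#0

  -- The product shows only that some degree exists. Its value follows from `D-equation`, without
  -- counting the selected indices.
  A-degree : ∃[ d ] Monic d A
  A-degree = ∏-closed (λ f → ∃[ d ] Monic d f)
    (0 , refl , λ { {suc k} _ → refl })
    (λ (a , fa) (b , gb) → a ℕ.+ b , monic-⊛ fa gb)
    (λ i → monic-when (not ([ p ∣] (suc i)) ∧ ([ q ∣] (suc i) ∨ [ r ∣] (suc i)))) n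
    where
    monic-when : ∀ {a} b → ∃[ d ] Monic d (X⊖ a when b)
    monic-when true  = 1 , X⊖-monic _
    monic-when false = 0 , refl , λ { {suc k} _ → refl }

  D : ℕ
  D = proj₁ A-degree

  A-monic : Monic D A
  A-monic = proj₂ A-degree

  D-equation : D ℕ.+ p ℕ.+ r ℕ.+ q ≡ p ℕ.* r ℕ.+ q ℕ.* p ℕ.+ 1
  D-equation = monic-unique 1≉0
    (monic-⊛ (monic-⊛ (monic-⊛ A-monic (X^-1-monic 0<p)) (X^-1-monic 0<r)) (X^-1-monic 0<q))
    (monic-cong (K⟦x⟧.sym A-equation) (monic-⊛ (monic-⊛ (X^-1-monic (ℕ.*-mono-< 0<p 0<r)) (X^-1-monic (ℕ.*-mono-< 0<q 0<p))) (X^-1-monic {1} z<s)))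
    where
    monic-cong : ∀ {d f g} → f ≐ g → Monic d f → Monic d g
    monic-cong f≐g (fd≈1 , f>d≈0) = trans (sym (f≐g _)) fd≈1 , λ d<k → trans (sym (f≐g _)) (f>d≈0 d<k)

  -- Each side of `A-equation` has three factors x^m - 1, all with constant term -1.
  A-zero : A 0 ≈ 1#
  A-zero = cancel (cancel (cancel (begin
    A 0 * - 1# * - 1# * - 1#    ≈⟨ *-cong (*-cong (*-congˡ (at-zero 0<p)) (at-zero 0<r)) (at-zero 0<q) ⟨
    (A ⊛ x^ p −1 ⊛ x^ r −1 ⊛ x^ q −1) 0  ≈⟨ A-equation 0 ⟩
    (x^ (p ℕ.* r) −1 ⊛ x^ (q ℕ.* p) −1 ⊛ x^ 1 −1) 0
      ≈⟨ *-cong (*-cong (at-zero (ℕ.*-mono-< 0<p 0<r)) (at-zero (ℕ.*-mono-< 0<q 0<p))) (at-zero {1} z<s) ⟩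
    - 1# * - 1# * - 1#          ≈⟨ *-congʳ (*-congʳ (*-identityˡ _)) ⟨
    1# * - 1# * - 1# * - 1#     ∎)))
    where
    open SetoidReasoning setoid
    at-zero : ∀ {m} → 0 < m → x^ m −1 0 ≈ - 1#
    at-zero {m} 0<m = trans (+-congʳ (X^-coeff-≢ {m} {0} (ℕ.<⇒≢ 0<m))) (+-identityˡ _)
    cancel : ∀ {a b} → a * - 1# ≈ b * - 1# → a ≈ b
    cancel {a} {b} eq = -‿injective (begin
      - a       ≈⟨ -1*x≈-x a ⟨
      - 1# * a  ≈⟨ *-comm _ _ ⟩
      a * - 1#  ≈⟨ eq ⟩
      b * - 1#  ≈⟨ *-comm _ _ ⟩
      - 1# * b  ≈⟨ -1*x≈-x b ⟩
      - b       ∎)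

  -- `A-equation` presents A as a quotient of integer polynomials by factors x^m - 1, and such
  -- divisions preserve integrality.
  A-integer : ∀ k → IsInteger (A k)
  A-integer = integer-quotient 0<p (integer-quotient 0<r (integer-quotient 0<q
    (λ k → cast (A-equation k) (integer-⊛ (integer-⊛ (X^-1-integer (p ℕ.* r)) (X^-1-integer (q ℕ.* p))) (X^-1-integer 1) k))))
    where
    cast : ∀ {a b} → a ≈ b → IsInteger b → IsInteger a
    cast a≈b (i , j , b≈) = i , j , trans a≈b b≈

  ψ-coeff : ∀ k → ψ k ≈ (X ⊛^ (q ℕ.* r) ⊛ A) k - A k
  ψ-coeff k = trans (ψ≐ k) (trans (⊛-distribʳ A (X ⊛^ (q ℕ.* r)) _ k) (+-congˡ (trans
    (sym (-‿distribˡ-⊛ 𝟏 A k)) (-‿cong (⊛-identityˡ A k)))))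
    where
    open RingProperties K⟦x⟧.ring using () renaming (-‿distribˡ-* to -‿distribˡ-⊛)

  ψ-low : ∀ {k} → k < q ℕ.* r → ψ k ≈ - A k
  ψ-low {k} k<qr = trans (ψ-coeff k) (trans (+-congʳ (X^⊛-< A k<qr)) (+-identityˡ _))

  ψ-high : D < q ℕ.* r → ∀ j → ψ (q ℕ.* r ℕ.+ j) ≈ A j
  ψ-high D<qr j = trans (ψ-coeff (q ℕ.* r ℕ.+ j)) (trans (+-cong (X^⊛-+ (q ℕ.* r) A j)
    (trans (-‿cong (proj₂ A-monic (ℕ.<-≤-trans D<qr (ℕ.m≤m+n _ j)))) -0#≈0#)) (+-identityʳ _))

  ψ-integer : ∀ k → IsInteger (ψ k)
  ψ-integer k = proj₁ i , proj₁ (proj₂ i) , trans (ψ≐ k) (proj₂ (proj₂ i))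
    where i = integer-⊛ (X^-1-integer (q ℕ.* r)) A-integer k

  D+p+r≡ : D ℕ.+ p ℕ.+ r ≡ p ℕ.* r ℕ.+ (p ℕ.∸ 1) ℕ.* q ℕ.+ 1
  D+p+r≡ = ℕ.+-cancelʳ-≡ q _ _ (≡.trans D-equation (rearrange p 0<p))
    where
    rearrange : ∀ p → 0 < p → p ℕ.* r ℕ.+ q ℕ.* p ℕ.+ 1 ≡ p ℕ.* r ℕ.+ (p ℕ.∸ 1) ℕ.* q ℕ.+ 1 ℕ.+ q
    rearrange (suc p) _ = identity p q r
      where
      identity : ∀ p q r → suc p ℕ.* r ℕ.+ q ℕ.* suc p ℕ.+ 1 ≡ suc p ℕ.* r ℕ.+ p ℕ.* q ℕ.+ 1 ℕ.+ q
      identity = solve-∀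

  -- Multiplying A by 1 + x + ⋯ + x^(r−1) sums its coefficients over windows of length r.
  no-long-gap : ∀ d → d ℕ.+ r ℕ.+ p ≤ D → (∀ {k} → d < k → k < d ℕ.+ r ℕ.+ p → A k ≈ 0#) → ⊥
  no-long-gap d d+r+p≤D A≈0 with hits-window 0<p q<r (d ℕ.+ r) (ℕ.≤-trans d+r+p≤D D≤)
    where
    D≤ : D ≤ p ℕ.* r ℕ.+ (p ℕ.∸ 1) ℕ.* q
    D≤ = ℕ.+-cancelʳ-≤ 1 _ _ (ℕ.≤-trans (ℕ.+-monoʳ-≤ D 0<p)
      (ℕ.≤-trans (ℕ.m≤m+n _ r) (ℕ.≤-reflexive D+p+r≡)))
  ... | v , u , v<r , u<p , d+r≤m , m<d+r+p = #-irrefl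
    (trans (sym (proj₂ positive)) (trans (sym (A-summed m)) (⊛-vanishes A (∑X^ 1 r) m outside)))
    (char0 (proj₁ positive))
    where
    m : ℕ
    m = p ℕ.* v ℕ.+ q ℕ.* u
    positive : IsPositive ((∑X^ p r ⊛ ∑X^ q p) m)
    positive = positive-⊛ (∑X^-natural p r) (∑X^-natural q p) (p ℕ.* v) (∑X^-positive p v<r) (∑X^-positive q u<p)
    -- For j < r the index i = m - j exceeds d because d + r ≤ m, which is why the window was taken
    -- to start at d + r; and i ≤ m < d + r + p, so A vanishes at i.
    outside : ∀ i j → i ℕ.+ j ≡ m → A i * ∑X^ 1 r j ≈ 0#
    outside i j i+j≡m with r ℕ.≤? j
    ... | yes r≤j = trans (*-congˡ (∑X^-above r≤j)) (zeroʳ _)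
    ... | no r≰j  = trans (*-congʳ (A≈0 d<i (ℕ.≤-<-trans (ℕ.≤-trans (ℕ.m≤m+n i j) (ℕ.≤-reflexive i+j≡m)) m<d+r+p))) (zeroˡ _)
      where
      d<i : d < i
      d<i = ℕ.+-cancelʳ-< j d i (ℕ.<-≤-trans (ℕ.+-monoʳ-< d (ℕ.≰⇒> r≰j)) (ℕ.≤-trans d+r≤m (ℕ.≤-reflexive (≡.sym i+j≡m))))

-- Expansions, degrees and maximum gaps from a decidable support.

toList-∷ʳ : ∀ {a} {A : Set a} (xs : List A) x → toList (xs List⁺.∷ʳ x) ≡ xs ∷ʳ x
toList-∷ʳ []       x = ≡.refl
toList-∷ʳ (_ ∷ xs) x = ≡.refl

-- `List⁺.last` inspects the tail through `initLast`, so the tail is a variable tied to `xs ∷ʳ x` by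
-- an equation; matching on that view then lets it compute.
last-∷ : ∀ {a} {A : Set a} (y : A) xs {x} zs → zs ≡ xs ∷ʳ x → List⁺.last (y List⁺.∷ zs) ≡ x
last-∷ y xs       zs           zs≡ with initLast zs
last-∷ y []       .[]          ()  | []
last-∷ y (_ ∷ _)  .[]          ()  | []
last-∷ y xs       .(ws ∷ʳ w)   zs≡ | ws ∷ʳ′ w = ∷ʳ-injectiveʳ ws xs zs≡

last-∷ʳ : ∀ {a} {A : Set a} (xs : List A) x → List⁺.last (xs List⁺.∷ʳ x) ≡ x
last-∷ʳ []       x = ≡.refl
last-∷ʳ (y ∷ xs) x = last-∷ y xs (xs ∷ʳ x) ≡.refl

module Support {c ℓ₁ ℓ₂} (K : HeytingField c ℓ₁ ℓ₂) where

  open HeytingField K using (_#_; heytingCommutativeRing; #-irrefl)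
  open HeytingCommutativeRing heytingCommutativeRing using (commutativeRing)
  open HeytingProperties heytingCommutativeRing using (#-congʳ; 1#0)
  open CommutativeRing commutativeRing hiding (_-_)
  open RingProperties ring using (-0#≈0#; -‿involutive)
  open PowerSeries commutativeRing using (Monic)
  open Polynomials K using (coeff-⊞)

  coeff-monomial : ∀ a e → coeff K (monomial K a e) e ≈ a
  coeff-monomial a zero    = refl
  coeff-monomial a (suc e) = coeff-monomial a e

  coeff-monomial-≢ : ∀ a {e k} → k ≢ e → coeff K (monomial K a e) k ≈ 0#
  coeff-monomial-≢ a {zero}  {zero}  k≢e = contradiction ≡.refl k≢e
  coeff-monomial-≢ a {zero}  {suc k} k≢e = refl
  coeff-monomial-≢ a {suc e} {zero}  k≢e = refl
  coeff-monomial-≢ a {suc e} {suc k} k≢e = coeff-monomial-≢ a (λ k≡e → k≢e (≡.cong suc k≡e))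

  sumOfTerms : List (Carrier × ℕ) → Poly K
  sumOfTerms ts = foldr (_⊞_ K) [] (map (λ (a , e) → monomial K a e) ts)

  module _ (f : ℕ → Carrier) where

    term : ℕ → Carrier × ℕ
    term e = f e , e

    coeff-∉ : ∀ {es k} → (∀ {e} → e ∈ es → k ≢ e) → coeff K (sumOfTerms (map term es)) k ≈ 0#
    coeff-∉ {[]}     k∉ = refl
    coeff-∉ {e ∷ es} {k} k∉ = trans (coeff-⊞ (monomial K (f e) e) (sumOfTerms (map term es)) k)
      (trans (+-cong (coeff-monomial-≢ (f e) (k∉ (here ≡.refl))) (coeff-∉ (λ e∈ → k∉ (there e∈)))) (+-identityˡ _))

    coeff-∈ : ∀ {es k} → AllPairs _<_ es → k ∈ es → coeff K (sumOfTerms (map term es)) k ≈ f k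
    coeff-∈ {e ∷ es} {k} (e<es ∷ _) (here ≡.refl) = trans (coeff-⊞ (monomial K (f e) e) (sumOfTerms (map term es)) k)
      (trans (+-cong (coeff-monomial (f e) e) (coeff-∉ (λ e′∈ → ℕ.<⇒≢ (All.lookup e<es e′∈)))) (+-identityʳ _))
    coeff-∈ {e ∷ es} {k} (e<es ∷ sorted) (there k∈) = trans (coeff-⊞ (monomial K (f e) e) (sumOfTerms (map term es)) k)
      (trans (+-cong (coeff-monomial-≢ (f e) (ℕ.>⇒≢ (All.lookup e<es k∈))) (coeff-∈ sorted k∈)) (+-identityˡ _))

  module FromDecidableSupport (f : Poly K) (N : ℕ)
    (nonzero? : ∀ k → coeff K f k # 0# ⊎ coeff K f k ≈ 0#)
    (top : coeff K f N # 0#) (above : ∀ {k} → N < k → coeff K f k ≈ 0#) where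

    support? : U.Decidable (λ k → coeff K f k # 0#)
    support? k with nonzero? k
    ... | inj₁ fk#0 = yes fk#0
    ... | inj₂ fk≈0 = no (#-irrefl fk≈0)

    -- `N` is appended rather than filtered, so that the list is visibly nonempty and the degree can
    -- be read off its end.
    exponents : List ℕ
    exponents = filter support? (upTo N) ∷ʳ N

    private
      below : ∀ {k} → k ∈ filter support? (upTo N) → k < N × coeff K f k # 0#
      below k∈ with ∈-filter⁻ support? {xs = upTo N} k∈
      ... | k∈upTo , fk#0 = ∈-upTo⁻ k∈upTo , fk#0

    ∈-exponents⁻ : ∀ {k} → k ∈ exponents → k ≤ N × coeff K f k # 0#
    ∈-exponents⁻ k∈ with ∈-++⁻ (filter support? (upTo N)) k∈
    ... | inj₁ k∈′            = ℕ.<⇒≤ (proj₁ (below k∈′)) , proj₂ (below k∈′)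
    ... | inj₂ (here ≡.refl)  = ℕ.≤-refl , top

    ∈-exponents⁺ : ∀ {k} → k ≤ N → coeff K f k # 0# → k ∈ exponents
    ∈-exponents⁺ {k} k≤N fk#0 with k ℕ.≟ N
    ... | yes ≡.refl = ∈-++⁺ʳ _ (here ≡.refl)
    ... | no k≢N     = ∈-++⁺ˡ (∈-filter⁺ support? (∈-upTo⁺ (ℕ.≤∧≢⇒< k≤N k≢N)) fk#0)

    sorted : AllPairs _<_ exponents
    sorted = AllPairs.++⁺
      (AllPairs.filter⁺ support? (AllPairs.applyUpTo⁺₁ (λ i → i) N (λ i<j _ → i<j)))
      ([] ∷ []) (All.tabulate (λ k∈ → proj₁ (below k∈) ∷ []))

    private
      t : ℕ → Carrier × ℕ
      t = term (coeff K f)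

      terms : List⁺ (Carrier × ℕ)
      terms = map t (filter support? (upTo N)) List⁺.∷ʳ t N

      toList≡ : toList terms ≡ map t exponents
      toList≡ = ≡.trans (toList-∷ʳ _ (t N)) (≡.sym (map-++ t (filter support? (upTo N)) [ N ]))

      exponents≡ : map proj₂ (toList terms) ≡ exponents
      exponents≡ = ≡.trans (≡.cong (map proj₂) toList≡) (≡.trans (≡.sym (map-∘ exponents)) (map-id exponents))

    expansion : Expansion K f
    expansion = record
      { terms      = terms
      ; nonzero    = ≡.subst (All (λ a → proj₁ a # 0#)) (≡.sym toList≡)
                       (All.map⁺ (All.tabulate (λ k∈ → proj₂ (∈-exponents⁻ k∈))))
      ; increasing = ≡.subst (Linked _<_) (≡.sym exponents≡) (AllPairs⇒Linked sorted)
      ; expands    = λ k → trans (coefficient k)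
                       (reflexive (≡.cong (λ ts → coeff K (sumOfTerms ts) k) (≡.sym toList≡)))
      }
      where
      coefficient : ∀ k → coeff K f k ≈ coeff K (sumOfTerms (map t exponents)) k
      coefficient k with nonzero? k
      ... | inj₂ fk≈0 = trans fk≈0 (sym (coeff-∉ (coeff K f)
              λ { e∈ ≡.refl → #-irrefl fk≈0 (proj₂ (∈-exponents⁻ e∈)) }))
      ... | inj₁ fk#0 = sym (coeff-∈ (coeff K f) sorted (∈-exponents⁺ (ℕ.≮⇒≥ (λ N<k → #-irrefl (above N<k) fk#0)) fk#0))

    degree≡ : Expansion.degree expansion ≡ N
    degree≡ = ≡.cong proj₂ (last-∷ʳ (map t (filter support? (upTo N))) (t N))

    maxGap≡ : Expansion.maxGap expansion ≡ max 0 (gaps exponents)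
    maxGap≡ = ≡.cong (λ es → max 0 (gaps es)) exponents≡

  -- f = (x^Q − 1) A with deg A < Q consists of a copy of A and a shifted copy of −A.
  module TwoCopies (f : Poly K) (A : ℕ → Carrier) (Q D : ℕ) (D<Q : D < Q)
    (f-dichotomy : ∀ k → coeff K f k # 0# ⊎ coeff K f k ≈ 0#)
    (A-monic : Monic D A) (A-zero : A 0 ≈ 1#)
    (low : ∀ {k} → k < Q → coeff K f k ≈ - A k)
    (high : ∀ k → coeff K f (Q ℕ.+ k) ≈ A k)
    (gap-in-A : ∀ {d e} → e ≤ D → (∀ {k} → d < k → k < e → A k ≈ 0#) → e ℕ.∸ d ≤ Q ℕ.∸ D) where

    open SetoidReasoning setoid

    f-above : ∀ {k} → Q ℕ.+ D < k → coeff K f k ≈ 0#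
    f-above Q+D<k with ℕ.m≤n⇒∃[o]m+o≡n (ℕ.≤-trans (ℕ.m≤m+n Q D) (ℕ.<⇒≤ Q+D<k))
    ... | j , ≡.refl = trans (high j) (proj₂ A-monic (ℕ.+-cancelˡ-< Q D j Q+D<k))

    open FromDecidableSupport f (Q ℕ.+ D) f-dichotomy (#-congʳ (sym (trans (high D) (proj₁ A-monic))) 1#0) f-above public

    A-low : ∀ {k} → k < Q → coeff K f k ≈ 0# → A k ≈ 0#
    A-low {k} k<Q fk≈0 = begin
      A k        ≈⟨ -‿involutive (A k) ⟨
      - - A k    ≈⟨ -‿cong (trans (sym (low k<Q)) fk≈0) ⟩
      - 0#       ≈⟨ -0#≈0# ⟩
      0#         ∎

    D∈ : D ∈ exponents
    D∈ with f-dichotomy D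
    ... | inj₁ fD#0 = ∈-exponents⁺ (ℕ.m≤n+m D Q) fD#0
    ... | inj₂ fD≈0 = contradiction 1#0 (#-irrefl (trans (sym (proj₁ A-monic)) (A-low D<Q fD≈0)))

    Q∈ : Q ∈ exponents
    Q∈ = ∈-exponents⁺ (ℕ.m≤m+n Q D) (≡.subst (λ k → coeff K f k # 0#) (ℕ.+-identityʳ Q)
      (#-congʳ (sym (trans (high 0) A-zero)) 1#0))

    D-Q-consecutive : Consecutive exponents D Q
    D-Q-consecutive = D∈ , Q∈ , D<Q , split
      where
      split : ∀ {k} → k ∈ exponents → k ≤ D ⊎ Q ≤ k
      split {k} k∈ with k ℕ.≤? D | Q ℕ.≤? k
      ... | yes k≤D | _       = inj₁ k≤D
      ... | no _    | yes Q≤k = inj₂ Q≤k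
      ... | no k≰D  | no Q≰k  = contradiction (proj₂ (∈-exponents⁻ k∈)) (#-irrefl (begin
        coeff K f k    ≈⟨ low (ℕ.≰⇒> Q≰k) ⟩
        - A k          ≈⟨ -‿cong (proj₂ A-monic (ℕ.≰⇒> k≰D)) ⟩
        - 0#           ≈⟨ -0#≈0# ⟩
        0#             ∎))

    f-between : ∀ {d e k} → Consecutive exponents d e → d < k → k < e → coeff K f k ≈ 0#
    f-between {k = k} (_ , e∈ , _ , split) d<k k<e with f-dichotomy k
    ... | inj₂ fk≈0 = fk≈0
    ... | inj₁ fk#0 with split (∈-exponents⁺ (ℕ.≤-trans (ℕ.<⇒≤ k<e) (proj₁ (∈-exponents⁻ e∈))) fk#0)
    ...   | inj₁ k≤d = contradiction d<k (ℕ.≤⇒≯ k≤d)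
    ...   | inj₂ e≤k = contradiction k<e (ℕ.≤⇒≯ e≤k)

    -- D and Q are themselves exponents, so no pair of consecutive exponents straddles either of
    -- them: the pair lies within the lower copy of A, is squeezed between D and Q, or lies within
    -- the upper copy.
    largest : ∀ {d e} → Consecutive exponents d e → e ℕ.∸ d ≤ Q ℕ.∸ D
    largest {d} {e} consecutive@(_ , e∈ , d<e , split) with split D∈ | split Q∈
    ... | inj₂ e≤D | _        = gap-in-A e≤D λ d<k k<e →
      A-low (ℕ.<-trans k<e (ℕ.≤-<-trans e≤D D<Q)) (f-between consecutive d<k k<e)
    ... | inj₁ D≤d | inj₂ e≤Q = ℕ.∸-mono e≤Q D≤d
    ... | inj₁ D≤d | inj₁ Q≤d with ℕ.m≤n⇒∃[o]m+o≡n Q≤d | ℕ.m≤n⇒∃[o]m+o≡n (ℕ.≤-trans Q≤d (ℕ.<⇒≤ d<e))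
    ...   | d′ , ≡.refl | e′ , ≡.refl = ≡.subst (_≤ Q ℕ.∸ D) (≡.sym (ℕ.[m+n]∸[m+o]≡n∸o Q e′ d′))
      (gap-in-A (ℕ.+-cancelˡ-≤ Q _ _ (proj₁ (∈-exponents⁻ e∈))) λ {k} d′<k k<e′ →
        trans (sym (high k)) (f-between consecutive (ℕ.+-monoʳ-< Q d′<k) (ℕ.+-monoʳ-< Q k<e′)))

    maximum-gap : Expansion.maxGap expansion ≡ Q ℕ.∸ D
    maximum-gap = ≡.trans maxGap≡ (max-gap≡ sorted D-Q-consecutive largest)

    gap+degree : Expansion.maxGap expansion ℕ.+ Expansion.degree expansion ≡ Q ℕ.+ Q
    gap+degree = ≡.trans (≡.cong₂ ℕ._+_ maximum-gap degree≡) (ℕ-identity (ℕ.<⇒≤ D<Q))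
      where
      ℕ-identity : ∀ {D Q} → D ≤ Q → Q ℕ.∸ D ℕ.+ (Q ℕ.+ D) ≡ Q ℕ.+ Q
      ℕ-identity {D} {Q} D≤Q = ≡.trans (≡.cong (Q ℕ.∸ D ℕ.+_) (ℕ.+-comm Q D))
        (≡.trans (≡.sym (ℕ.+-assoc (Q ℕ.∸ D) D Q)) (≡.cong (ℕ._+ Q) (ℕ.m∸n+n≡m D≤Q)))

-- The identity in ℚ and the conclusion.

open import Data.Integer.Base using (+_)
open import Data.Nat.Base using (_*_; _∸_; _^_; _≥_)
open import Data.Product.Base using (Σ-syntax)
open import Data.Rational.Base using (_/_; _-_)

-- In the application, a = 2 n = 2 (q r) p, the degree is N = q r + D and the gap g = q r − D.
gap-over-p : ∀ g N a p .{{_ : ℕ.NonZero p}} → a ≡ (g ℕ.+ N) ℕ.* p → (+ g) / 1 ≡ (+ a) / p - (+ N) / 1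
gap-over-p g N a (suc d) ≡.refl = ℚ.toℚᵘ-injective (begin
  ℚ.toℚᵘ ((+ g) / 1)                                        ≈⟨ ℚ.toℚᵘ-fromℚᵘ (ℚᵘ.mkℚᵘ (+ g) 0) ⟩
  ℚᵘ.mkℚᵘ (+ g) 0                                              ≈⟨ ℚᵘ.*≡* equal ⟩
  ℚᵘ.mkℚᵘ (+ a) d ℚᵘ.- ℚᵘ.mkℚᵘ (+ N) 0
    ≈⟨ ℚᵘ.+-cong (ℚ.toℚᵘ-fromℚᵘ (ℚᵘ.mkℚᵘ (+ a) d)) (ℚᵘ.-‿cong (ℚ.toℚᵘ-fromℚᵘ (ℚᵘ.mkℚᵘ (+ N) 0))) ⟨
  ℚ.toℚᵘ ((+ a) / suc d) ℚᵘ.- ℚ.toℚᵘ ((+ N) / 1)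
    ≈⟨ ℚᵘ.+-congʳ (ℚ.toℚᵘ ((+ a) / suc d)) (ℚ.toℚᵘ-homo‿- ((+ N) / 1)) ⟨
  ℚ.toℚᵘ ((+ a) / suc d) ℚᵘ.+ ℚ.toℚᵘ (ℚ.- ((+ N) / 1))
    ≈⟨ ℚ.toℚᵘ-homo-+ ((+ a) / suc d) (ℚ.- ((+ N) / 1)) ⟨
  ℚ.toℚᵘ ((+ a) / suc d - (+ N) / 1)                        ∎)
  where
  open ℚᵘ.≃-Reasoning
  identity : ∀ x y z → x ℤ.* (z ℤ.* (+ 1)) ≡ ((x ℤ.+ y) ℤ.* z ℤ.* (+ 1) ℤ.+ ℤ.- y ℤ.* z) ℤ.* (+ 1)
  identity = ℤ.solve-∀
  equal : + g ℤ.* (+ suc d ℤ.* (+ 1)) ≡ (+ ((g ℕ.+ N) ℕ.* suc d) ℤ.* (+ 1) ℤ.+ ℤ.- (+ N) ℤ.* + suc d) ℤ.* (+ 1)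
  equal = ≡.trans (identity (+ g) (+ N) (+ suc d))
    (≡.cong (λ x → (x ℤ.* (+ 1) ℤ.+ ℤ.- (+ N) ℤ.* + suc d) ℤ.* (+ 1))
      (≡.trans (≡.cong (ℤ._* + suc d) (≡.sym (ℤ.pos-+ g N))) (≡.sym (ℤ.pos-* (g ℕ.+ N) (suc d)))))


theorem2 : ∀ {c ℓ₁ ℓ₂} (K : HeytingField c ℓ₁ ℓ₂) → CharacteristicZero K →
    ∀ {p₁ p₂ p₃ : ℕ} (op₁ : OddPrime p₁) → OddPrime p₂ → OddPrime p₃ →
    p₁ < p₂ → p₂ < p₃ →
    (p₂ ≥ 4 * (p₁ ∸ 1)) ⊎ (p₃ ≥ p₁ ^ 2) →
    let n = p₁ * p₂ * p₃ in
    ∀ (ζ : HeytingField.Carrier K) → PrimitiveRoot K n ζ →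
    Σ[ E ∈ Expansion K (Ψ K n ζ) ]
    (+ Expansion.maxGap E) / 1
    ≡ _/_ (+ (2 * n)) p₁ {{prime⇒nonZero (proj₁ op₁)}} - (+ Expansion.degree E) / 1
theorem2 K char0 {p₁} {p₂} {p₃} (prime₁ , _) (prime₂ , _) (prime₃ , _) p₁<p₂ p₂<p₃ condition ζ ζ-primitive =
  expansion , gap-over-p (Expansion.maxGap expansion) (Expansion.degree expansion) (2 * n) p₁ {{prime⇒nonZero prime₁}}
    (≡.trans (rearrange p₁ p₂ p₃) (≡.cong (_* p₁) (≡.sym gap+degree)))
  where
  open InverseCyclotomic K char0 prime₁ prime₂ prime₃ p₁<p₂ p₂<p₃ ζ ζ-primitive

  D+p₁+p₃≤ : D ℕ.+ p₁ ℕ.+ p₃ ≤ suc (p₂ * p₃)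
  D+p₁+p₃≤ = ℕ.≤-trans (ℕ.≤-reflexive (≡.trans D+p+r≡ (ℕ.+-comm _ 1)))
    (s≤s (slack (1<prime prime₁) p₁<p₂ p₂<p₃ condition))

  D<p₂p₃ : D < p₂ * p₃
  D<p₂p₃ = bound⇒D<Q (1<prime prime₁) (0<prime prime₃) D+p₁+p₃≤

  gap-in-A : ∀ {d e} → e ≤ D → (∀ {k} → d < k → k < e → HeytingField._≈_ K (A k) (HeytingField.0# K)) →
    e ∸ d ≤ p₂ * p₃ ∸ D
  -- A longer gap would have length at least p₃ + p₁ by `gap-length` and would end no later than D,
  -- which `no-long-gap` excludes.
  gap-in-A {d} {e} e≤D A≈0 = ℕ.≮⇒≥ λ gap< →
    let long = gap-length {d = d} {e = e} D<p₂p₃ D+p₁+p₃≤ gap< in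
    no-long-gap d (ℕ.≤-trans long e≤D) (λ d<k k< → A≈0 d<k (ℕ.<-≤-trans k< long))

  open Support.TwoCopies K (Ψ K n ζ) A (p₂ * p₃) D D<p₂p₃ (λ k → integer-dichotomy (ψ-integer k))
    A-monic A-zero ψ-low (ψ-high D<p₂p₃)
    gap-in-A

  rearrange : ∀ p q r → 2 * (p * q * r) ≡ (q * r ℕ.+ q * r) * p
  rearrange = solve-∀
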